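{- The generating function for $\frac12X_{C_{n,v}}$, where $C_{n,v}$ is the cycle $C_n$ twinned at a vertex $v$, has the following $e$-positive rational expression: $$\frac12\sum_{n\ge 3}X_{C_{n,v}}z^{n+1}=\sum_{i\ge 4}(2i^2-5i)e_iz^i+\frac{e_1z\,F_3+F_2\sum_{i\ge 3}(i-1)e_iz^i+e_2z^2\sum_{i\ge 3}(2i^2-6i+2)e_iz^i}{1-\sum_{i\ge 2}(i-1)e_iz^i},$$ where $F_2=\sum_{i\ge 3}(2i^2-5i)e_iz^i$ and $F_3=\sum_{i\ge 4}(i-1)(i-3)e_iz^i$.
   Context: The chromatic symmetric function of a finite simple graph $H=(V,E)$ is $X_H=\sum_\kappa\prod_{u\in V}x_{\kappa(u)}$, the sum over all proper colorings $\kappa:V\to\mathbb{Z}_{>0}$. $C_n$ is the cycle on $n$ vertices. The twin of a graph at a vertex $v$ is obtained by adding a new vertex $v'$ joined to $v$ and to all neighbors of $v$. $e_i$ is the $i$-th elementary symmetric function; a symmetric function is $e$-positive if its expansion in the elementary basis has nonnegative coefficients, and a power series in $z$ over symmetric functions is $e$-positive if each of its coefficients is. -}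

module Defs where

open import Data.Bool using (if_then_else_)
open import Data.Empty using (⊥)
open import Data.Fin using (Fin; zero; suc; toℕ)
import Data.Fin.Properties as Fin
open import Data.Integer using (+_)
open import Data.List using (List; []; _∷_; allFin; applyUpTo; cartesianProductWith; filter; foldr; length; map; zipWith)
import Data.List as List
open import Data.List.Relation.Unary.All using (All; all?)
open import Data.List.Relation.Unary.Linked using (Linked)
open import Data.List.Relation.Unary.Unique.Propositional using (Unique)
open import Data.Nat using (ℕ; zero; suc; _∸_; _≤_; _≥_; _<_; s≤s; _≟_; _≤?_)
open import Data.Nat.ListAction using (sum)
open import Data.Nat.Properties using (1+n≢n; suc-injective)
open import Data.Product using (Σ-syntax; _×_; _,_)
open import Data.Rational using (ℚ; 0ℚ; 1ℚ; _/_)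
import Data.Rational as ℚ
import Data.Rational.Properties as ℚ
open import Data.Sum using (_⊎_; inj₁; inj₂; swap)
open import Data.Vec using (Vec; []; _∷_; count; lookup)
open import Relation.Binary.PropositionalEquality using (_≡_; _≢_; refl; sym; trans; cong; cong₂)
open import Relation.Nullary using (¬_; Dec; yes; no; does; ¬?; _×-dec_; _⊎-dec_; _→-dec_)

-- a₁ ∷ … ∷ aₖ ∷ [] stands for x₁^a₁ ⋯ xₖ^aₖ.  Lists that differ by trailing
-- zeros name the same monomial, so FPS models ℚ[[x₁, x₂, …]].
Monomial : Set
Monomial = List ℕ

FPS : Set
FPS = Monomial → ℚ

infix 4 _≈_
_≈_ : FPS → FPS → Set
f ≈ g = ∀ α → f α ≡ g α

∑ℚ : List ℚ → ℚ
∑ℚ = foldr ℚ._+_ 0ℚ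

𝟘 : FPS
𝟘 _ = 0ℚ

𝟙 : FPS
𝟙 []          = 1ℚ
𝟙 (zero  ∷ α) = 𝟙 α
𝟙 (suc _ ∷ _) = 0ℚ

infixl 6 _+_
_+_ : FPS → FPS → FPS
(f + g) α = f α ℚ.+ g α

infixr 8 _•_
_•_ : ℚ → FPS → FPS
(c • f) α = c ℚ.* f α

-- (f * g) α = ∑ f β · g γ over all pairs of exponent lists with β + γ = α
-- entrywise, splitting one exponent at a time.
infixl 7 _*_
_*_ : FPS → FPS → FPS
(f * g) []      = f [] ℚ.* g []
(f * g) (a ∷ α) =
  ∑ℚ (applyUpTo (λ b → ((λ β → f (b ∷ β)) * (λ γ → g ((a ∸ b) ∷ γ))) α) (suc a))

∑ : List FPS → FPS
∑ = foldr _+_ 𝟘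

∏ : List FPS → FPS
∏ = foldr _*_ 𝟙

-- The sum of all squarefree monomials of degree i.
e : ℕ → FPS
e i α = if does (sum α ≟ i ×-dec all? (_≤? 1) α) then 1ℚ else 0ℚ

IsPartition : List ℕ → Set
IsPartition μ = Linked _≥_ μ × All (0 <_) μ

e[_] : List ℕ → FPS
e[ μ ] = ∏ (map e μ)

record EExpansion (f : FPS) : Set where
  field
    support    : List (List ℕ)
    partitions : All IsPartition support
    unique     : Unique support
    coeff      : List ℕ → ℚ
    expands    : f ≈ ∑ (map (λ μ → coeff μ • e[ μ ]) support)

EPositive : FPS → Set
EPositive f = Σ[ E ∈ EExpansion f ] (let open EExpansion E in All (λ μ → 0ℚ ℚ.≤ coeff μ) support)

-- Power series in z: A n is the coefficient of zⁿ.
Series : Set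
Series = ℕ → FPS

infix 4 _≋_
_≋_ : Series → Series → Set
A ≋ B = ∀ n → A n ≈ B n

EPositiveSeries : Series → Set
EPositiveSeries A = ∀ n → EPositive (A n)

infix 9 _z^_
_z^_ : FPS → ℕ → Series
(f z^ i) n = if does (n ≟ i) then f else 𝟘

-- ∑≥ k a is ∑_{i ≥ k} aᵢ zⁱ.
∑≥ : (k : ℕ) → ((i : ℕ) → k ≤ i → FPS) → Series
∑≥ k a n with k ≤? n
... | yes k≤n = a n k≤n
... | no  _   = 𝟘

infixl 6 _⊕_ _⊖_
_⊕_ : Series → Series → Series
(A ⊕ B) n = A n + B n

_⊖_ : Series → Series → Series
(A ⊖ B) n = A n + (ℚ.- 1ℚ) • B n

infixr 8 _⊙_
_⊙_ : ℚ → Series → Series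
(c ⊙ A) n = c • A n

infixl 7 _⊛_
_⊛_ : Series → Series → Series
(A ⊛ B) n = ∑ (applyUpTo (λ i → A i * B (n ∸ i)) (suc n))

-- The coefficients of zⁿ, …, z¹, z⁰ in the reciprocal of A, found by solving
-- A ⊛ B ≋ 𝟙 z^ 0 for B.  Only meaningful when A has constant term 𝟙.
recipCoeffs : Series → ℕ → List FPS
recip : Series → Series

recipCoeffs A zero    = recip A zero ∷ []
recipCoeffs A (suc n) = recip A (suc n) ∷ recipCoeffs A n

recip A zero    = 𝟙
recip A (suc n) =
  (ℚ.- 1ℚ) • ∑ (zipWith _*_ (applyUpTo (λ i → A (suc i)) (suc n)) (recipCoeffs A n))

infixl 7 _⊘_
_⊘_ : Series → Series → Series
A ⊘ B = A ⊛ recip B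

private
  ∑ℚ-cong : ∀ {s t : ℕ → ℚ} → (∀ i → s i ≡ t i) → ∀ n → ∑ℚ (applyUpTo s n) ≡ ∑ℚ (applyUpTo t n)
  ∑ℚ-cong s≡t zero    = refl
  ∑ℚ-cong s≡t (suc n) = cong₂ ℚ._+_ (s≡t 0) (∑ℚ-cong (λ i → s≡t (suc i)) n)

  ∑ℚ-zero : ∀ {s : ℕ → ℚ} → (∀ i → s i ≡ 0ℚ) → ∀ n → ∑ℚ (applyUpTo s n) ≡ 0ℚ
  ∑ℚ-zero s≡0 zero    = refl
  ∑ℚ-zero s≡0 (suc n) = cong₂ ℚ._+_ (s≡0 0) (∑ℚ-zero (λ i → s≡0 (suc i)) n)

  *-congʳ : ∀ {f f′} g → f ≈ f′ → f * g ≈ f′ * g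
  *-congʳ g f≈f′ []      = cong (ℚ._* g []) (f≈f′ [])
  *-congʳ g f≈f′ (a ∷ α) =
    ∑ℚ-cong (λ b → *-congʳ (λ γ → g ((a ∸ b) ∷ γ)) (λ β → f≈f′ (b ∷ β)) α) (suc a)

  *-zeroˡ : ∀ g → 𝟘 * g ≈ 𝟘
  *-zeroˡ g []      = ℚ.*-zeroˡ (g [])
  *-zeroˡ g (a ∷ α) = ∑ℚ-zero (λ b → *-zeroˡ (λ γ → g ((a ∸ b) ∷ γ)) α) (suc a)

  *-identityˡ : ∀ g → 𝟙 * g ≈ g
  *-identityˡ g []      = ℚ.*-identityˡ (g [])
  *-identityˡ g (a ∷ α) = trans
    (cong₂ ℚ._+_ (*-identityˡ (λ γ → g (a ∷ γ)) α)
                 (∑ℚ-zero (λ b → *-zeroˡ (λ γ → g ((a ∸ suc b) ∷ γ)) α) a))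
    (ℚ.+-identityʳ (g (a ∷ α)))

  zipWith-applyUpTo : ∀ (s t : ℕ → FPS) n →
    zipWith _*_ (applyUpTo s n) (applyUpTo t n) ≡ applyUpTo (λ i → s i * t i) n
  zipWith-applyUpTo s t zero    = refl
  zipWith-applyUpTo s t (suc n) =
    cong (_ ∷_) (zipWith-applyUpTo (λ i → s (suc i)) (λ i → t (suc i)) n)

  recipCoeffs-applyUpTo : ∀ A n → recipCoeffs A n ≡ applyUpTo (λ i → recip A (n ∸ i)) (suc n)
  recipCoeffs-applyUpTo A zero    = refl
  recipCoeffs-applyUpTo A (suc n) = cong (recip A (suc n) ∷_) (recipCoeffs-applyUpTo A n)

  -1*p+p≡0 : ∀ p → (ℚ.- 1ℚ) ℚ.* p ℚ.+ p ≡ 0ℚ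
  -1*p+p≡0 p = trans
    (cong (ℚ._+ p) (trans (sym (ℚ.neg-distribˡ-* 1ℚ p)) (cong ℚ.-_ (ℚ.*-identityˡ p))))
    (ℚ.+-inverseˡ p)

⊛-recip : ∀ A → A 0 ≈ 𝟙 → A ⊛ recip A ≋ 𝟙 z^ 0
⊛-recip A A₀≈𝟙 zero α = trans (ℚ.+-identityʳ _)
  (trans (*-congʳ 𝟙 A₀≈𝟙 α) (*-identityˡ 𝟙 α))
⊛-recip A A₀≈𝟙 (suc n) α = trans
  (cong₂ ℚ._+_
    (trans (*-congʳ (recip A (suc n)) A₀≈𝟙 α) (*-identityˡ (recip A (suc n)) α))
    (cong (λ fs → ∑ fs α) (sym convolution)))
  (-1*p+p≡0 (∑ (zipWith _*_ (applyUpTo (λ i → A (suc i)) (suc n)) (recipCoeffs A n)) α))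
  where
  convolution :
    zipWith _*_ (applyUpTo (λ i → A (suc i)) (suc n)) (recipCoeffs A n)
      ≡ applyUpTo (λ i → A (suc i) * recip A (n ∸ i)) (suc n)
  convolution = trans
    (cong (zipWith _*_ (applyUpTo (λ i → A (suc i)) (suc n))) (recipCoeffs-applyUpTo A n))
    (zipWith-applyUpTo (λ i → A (suc i)) (λ i → recip A (n ∸ i)) (suc n))

record Graph (n : ℕ) : Set₁ where
  infix 4 _~_ _~?_
  field
    _~_      : Fin n → Fin n → Set
    _~?_     : ∀ u w → Dec (u ~ w)
    ~-sym    : ∀ {u w} → u ~ w → w ~ u
    ~-irrefl : ∀ {u} → ¬ (u ~ u)

Next : ∀ {n} → Fin n → Fin n → Set
Next {n} u w = (toℕ w ≡ suc (toℕ u)) ⊎ (suc (toℕ u) ≡ n × toℕ w ≡ 0)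

next? : ∀ {n} (u w : Fin n) → Dec (Next u w)
next? {n} u w = (toℕ w ≟ suc (toℕ u)) ⊎-dec ((suc (toℕ u) ≟ n) ×-dec (toℕ w ≟ 0))

Next-irrefl : ∀ {n} → 3 ≤ n → {u : Fin n} → ¬ Next u u
Next-irrefl _ (inj₁ u≡1+u) = 1+n≢n (sym u≡1+u)
Next-irrefl (s≤s (s≤s _)) (inj₂ (1+u≡n , u≡0)) with trans (sym u≡0) (suc-injective 1+u≡n)
... | ()

cycle : (n : ℕ) → 3 ≤ n → Graph n
cycle n 3≤n = record
  { _~_      = λ u w → Next u w ⊎ Next w u
  ; _~?_     = λ u w → next? u w ⊎-dec next? w u
  ; ~-sym    = swap
  ; ~-irrefl = λ { (inj₁ p) → Next-irrefl 3≤n p ; (inj₂ p) → Next-irrefl 3≤n p }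
  }

-- The new vertex v′ is zero; the old vertices are shifted by suc.
module Twin {n : ℕ} (G : Graph n) (v : Fin n) where
  open Graph G

  Adj : Fin (suc n) → Fin (suc n) → Set
  Adj zero    zero    = ⊥
  Adj zero    (suc u) = u ≡ v ⊎ u ~ v
  Adj (suc u) zero    = u ≡ v ⊎ u ~ v
  Adj (suc u) (suc w) = u ~ w

  adj? : ∀ u w → Dec (Adj u w)
  adj? zero    zero    = no λ ()
  adj? zero    (suc u) = (u Fin.≟ v) ⊎-dec (u ~? v)
  adj? (suc u) zero    = (u Fin.≟ v) ⊎-dec (u ~? v)
  adj? (suc u) (suc w) = u ~? w

  Adj-sym : ∀ u w → Adj u w → Adj w u
  Adj-sym zero    (suc _) p = p
  Adj-sym (suc _) zero    p = p
  Adj-sym (suc _) (suc _) p = ~-sym p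

  Adj-irrefl : ∀ u → ¬ Adj u u
  Adj-irrefl (suc _) p = ~-irrefl p

twin : ∀ {n} → Graph n → Fin n → Graph (suc n)
twin G v = record
  { _~_      = Adj
  ; _~?_     = adj?
  ; ~-sym    = λ {u} {w} → Adj-sym u w
  ; ~-irrefl = λ {u} → Adj-irrefl u
  } where open Twin G v

Coloring : ℕ → ℕ → Set
Coloring k n = Vec (Fin k) n

colorings : ∀ k n → List (Coloring k n)
colorings k zero    = [] ∷ []
colorings k (suc n) = cartesianProductWith _∷_ (allFin k) (colorings k n)

module _ {n : ℕ} (G : Graph n) where
  open Graph G

  Proper : ∀ {k} → Coloring k n → Set
  Proper κ = ∀ u w → u ~ w → lookup κ u ≢ lookup κ w

  proper? : ∀ {k} (κ : Coloring k n) → Dec (Proper κ)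
  proper? κ = Fin.all? λ u → Fin.all? λ w → (u ~? w) →-dec ¬? (lookup κ u Fin.≟ lookup κ w)

-- ∏ᵤ x_{κ(u)} is the monomial α.
HasContent : ∀ {n} (α : Monomial) → Coloring (length α) n → Set
HasContent α κ = ∀ c → count (Fin._≟ c) κ ≡ List.lookup α c

hasContent? : ∀ {n} (α : Monomial) (κ : Coloring (length α) n) → Dec (HasContent α κ)
hasContent? α κ = Fin.all? λ c → count (Fin._≟ c) κ ≟ List.lookup α c

-- The coefficient of α counts the proper colorings with monomial α; such a
-- coloring uses only colors among the first length α, so a finite palette
-- loses nothing.
X : ∀ {n} → Graph n → FPS
X {n} G α =
  + length (filter (λ κ → proper? G κ ×-dec hasContent? α κ) (colorings (length α) n)) / 1

{-# OPTIONS --safe #-}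
module Submission where

-- Color the twin v′ with a, the vertex v with b ≠ a; the rest of the cycle is a
-- walk avoiding equal neighbors whose two ends avoid a and b.  With y_c = x_c z,
-- t_c = y_c / (1 + y_c), T = ∑ t_c and E = ∏ (1 + y_c) = ∑ eᵢ zⁱ, the transfer
-- equations give (1 − T) V = (T − t_a − t_b) (1 − t_a − t_b) for the generating
-- function V of such walks.  Writing θ = z d/dz one has θE = E T, so that
-- E (1 − T) = E − θE is the denominator, and (θ² − θ)E = E (T² − ∑ t_c²).  Since
-- y_c t_c = y_c − t_c, the sum over a ≠ b of y_a y_b E (1 − T) V is linear in E,
-- θE and (θ² − θ)E over the polynomials in e₁ z and e₂ z², and comparing
-- coefficients of the eᵢ gives the numerator.

open import Algebra.Bundles using (CommutativeRing)
import Algebra.Properties.Ring as RingProperties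
import Algebra.Properties.Semiring.Sum as Sum
import Algebra.Solver.Ring as RingSolver
open import Algebra.Solver.Ring.AlmostCommutativeRing using (fromCommutativeRing; _-Raw-AlmostCommutative⟶_)
open import Data.Bool using (if_then_else_; true; false)
import Data.Bool.Properties as Bool
open import Data.Empty using (⊥-elim)
open import Data.Fin using (Fin; zero; suc; toℕ; fromℕ; inject₁)
open import Data.Fin.Induction using (<-weakInduction)
import Data.Fin.Properties as Fin
open import Data.Fin.Relation.Unary.Top using (view; ‵fromℕ; ‵inject₁)
open import Data.Integer as ℤ using (ℤ; 0ℤ; 1ℤ; +_) renaming (_*_ to _·_; _+_ to _+ᶻ_)
import Data.Integer.Properties as ℤ
open import Data.Integer.Solver using () renaming (module +-*-Solver to ℤSolver)
open import Data.List using (List; []; _∷_; _++_; applyUpTo; cartesianProductWith; filter; length; map; tabulate; zipWith)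
import Data.List as List
import Data.List.Properties as List
open import Data.List.Membership.Propositional using (_∈_)
open import Data.List.Relation.Binary.Permutation.Propositional as ↭ using (_↭_; ↭-sym)
open import Data.List.Relation.Binary.Permutation.Propositional.Properties using (All-resp-↭)
open import Data.List.Relation.Unary.All as All using (All; []; _∷_)
import Data.List.Relation.Unary.All.Properties as All
open import Data.List.Relation.Unary.AllPairs using ([]; _∷_)
open import Data.List.Relation.Unary.Any using (here; there; any?)
open import Data.List.Relation.Unary.Unique.Propositional using (Unique)
import Data.List.Sort as Sort
open import Data.Maybe using (Maybe; just; nothing)
open import Data.Nat using (ℕ; zero; suc; _≤_; _<_; _≟_; _≤?_; z≤n; s≤s; _∸_)
import Data.Nat as ℕ
import Data.Nat.Properties as ℕ
open import Data.Product using (_×_; _,_; proj₁; proj₂; ∃)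
open import Data.Rational as ℚ using (ℚ; 0ℚ; 1ℚ; ½; _/_)
import Data.Rational.Properties as ℚ
open import Data.Rational.Unnormalised as ℚᵘ using (mkℚᵘ; *≡*)
import Data.Rational.Unnormalised.Properties as ℚᵘ
open import Data.Sum as Sum⊎ using (_⊎_; inj₁; inj₂)
open import Data.Vec using (Vec; []; _∷_; _∷ʳ_; count; lookup)
import Defs as D
open import Function using (_∘_; case_of_; id)
open import Level using (0ℓ)
open import Relation.Binary.Construct.Flip.EqAndOrd using () renaming (decTotalOrder to flipOrder)
open import Relation.Binary.PropositionalEquality as ≡ using (_≡_; _≢_)
import Relation.Binary.Reasoning.Setoid as SetoidReasoning
open import Relation.Nullary using (Dec; yes; no; does; ¬_; contradiction; _×-dec_)
open import Relation.Nullary.Decidable using (dec-true; dec-false)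
open import Relation.Unary using (Decidable)

-- Power series rings

-- `FPS` comes with no ring laws, so the computation takes place in finitely many variables, in
-- nested power series rings that share one proof of those laws and one ring solver. The coefficient
-- of a monomial α is already visible in `length α` variables, so identities that hold for every
-- finite number of variables transfer back. Nothing is divided before the end: 1 / (1 + y) appears
-- as 1 - t, and the denominator is cancelled by multiplying with its reciprocal. The computation
-- naturally yields half the series as `F₂` plus the quotient, with `F₂` starting at i = 3, whereas
-- the sum in the theorem starts at i = 4. The extra term 3e₃z³ belongs to a cycle degenerated to
-- two vertices, whose twin is a triangle: it is half of 6e₃, in agreement with 2·9 - 5·3 = 3. The
-- quotient vanishes below z⁵, so dropping that term is the only adjustment.

record ℤ-Algebra : Set₁ where
  field
    commutativeRing : CommutativeRing 0ℓ 0ℓ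
  open CommutativeRing commutativeRing hiding (zero) public
  field
    -- An explicit homomorphism from ℤ lets the ring solver normalise integer coefficients; in a
    -- series ring it gives constant series.
    κ   : ℤ → Carrier
    κ-+ : ∀ i j → κ (i ℤ.+ j) ≈ κ i + κ j
    κ-* : ∀ i j → κ (i ℤ.* j) ≈ κ i * κ j
    κ-neg : ∀ i → κ (ℤ.- i) ≈ - κ i
    κ-0 : κ 0ℤ ≈ 0#
    κ-1 : κ 1ℤ ≈ 1#

module Solver (A : ℤ-Algebra) where
  open ℤ-Algebra A

  private
    morphism : ℤ.+-*-rawRing -Raw-AlmostCommutative⟶ fromCommutativeRing commutativeRing
    morphism = record
      { ⟦_⟧ = κ ; +-homo = κ-+ ; *-homo = κ-* ; -‿homo = κ-neg ; 0-homo = κ-0 ; 1-homo = κ-1 }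

    κ-≟ : ∀ i j → Maybe (κ i ≈ κ j)
    κ-≟ i j with i ℤ.≟ j
    ... | yes ≡.refl = just refl
    ... | no  _      = nothing

  open RingSolver ℤ.+-*-rawRing (fromCommutativeRing commutativeRing) morphism κ-≟ public

module PowerSeries (R : CommutativeRing 0ℓ 0ℓ) where
  open CommutativeRing R hiding (zero)
  open SetoidReasoning setoid
  open RingProperties (CommutativeRing.ring R) using (-0#≈0#)

  PS : Set
  PS = ℕ → Carrier

  infix 4 _≈ₛ_
  _≈ₛ_ : PS → PS → Set
  A ≈ₛ B = ∀ n → A n ≈ B n

  tail : PS → PS
  tail A n = A (suc n)

  infixl 6 _+ₛ_
  _+ₛ_ : PS → PS → PS
  (A +ₛ B) n = A n + B n

  infixl 7 _*ₛ_
  -- Cauchy product by recursion on the tail of the first factor, the shape to which `⊛` unfolds as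
  -- well, so that `φ-⊛` is a direct induction.
  _*ₛ_ : PS → PS → PS
  (A *ₛ B) zero    = A 0 * B 0
  (A *ₛ B) (suc n) = A 0 * B (suc n) + (tail A *ₛ B) n

  -ₛ_ : PS → PS
  (-ₛ A) n = - A n

  0ₛ : PS
  0ₛ _ = 0#

  const : Carrier → PS
  const r zero    = r
  const r (suc _) = 0#

  1ₛ : PS
  1ₛ = const 1#

  *ₛ-cong : ∀ {A A′ B B′} → A ≈ₛ A′ → B ≈ₛ B′ → A *ₛ B ≈ₛ A′ *ₛ B′
  *ₛ-cong p q zero    = *-cong (p 0) (q 0)
  *ₛ-cong p q (suc n) = +-cong (*-cong (p 0) (q (suc n))) (*ₛ-cong (p ∘ suc) q n)

  +-interchange : ∀ a b c d → (a + b) + (c + d) ≈ (a + c) + (b + d)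
  +-interchange a b c d = begin
    (a + b) + (c + d) ≈⟨ +-assoc a b (c + d) ⟩
    a + (b + (c + d)) ≈⟨ +-congˡ (sym (+-assoc b c d)) ⟩
    a + ((b + c) + d) ≈⟨ +-congˡ (+-congʳ (+-comm b c)) ⟩
    a + ((c + b) + d) ≈⟨ +-congˡ (+-assoc c b d) ⟩
    a + (c + (b + d)) ≈⟨ sym (+-assoc a c (b + d)) ⟩
    (a + c) + (b + d) ∎

  *ₛ-distribʳ : ∀ C A B → (A +ₛ B) *ₛ C ≈ₛ A *ₛ C +ₛ B *ₛ C
  *ₛ-distribʳ C A B zero    = distribʳ (C 0) (A 0) (B 0)
  *ₛ-distribʳ C A B (suc n) = trans
    (+-cong (distribʳ (C (suc n)) (A 0) (B 0)) (*ₛ-distribʳ C (tail A) (tail B) n))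
    (+-interchange _ _ _ _)

  scale : Carrier → PS → PS
  scale r A n = r * A n

  scale-*ₛ : ∀ r A B → scale r A *ₛ B ≈ₛ scale r (A *ₛ B)
  scale-*ₛ r A B zero    = *-assoc r (A 0) (B 0)
  scale-*ₛ r A B (suc n) = trans
    (+-cong (*-assoc r (A 0) (B (suc n))) (scale-*ₛ r (tail A) B n)) (sym (distribˡ r _ _))

  0-*ₛ : ∀ B → 0ₛ *ₛ B ≈ₛ 0ₛ
  0-*ₛ B zero    = zeroˡ (B 0)
  0-*ₛ B (suc n) = trans (+-cong (zeroˡ _) (0-*ₛ B n)) (+-identityˡ 0#)

  const-*ₛ : ∀ r B → const r *ₛ B ≈ₛ scale r B
  const-*ₛ r B zero    = refl
  const-*ₛ r B (suc n) = trans (+-congˡ (0-*ₛ B n)) (+-identityʳ _)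

  *ₛ-assoc : ∀ A B C → (A *ₛ B) *ₛ C ≈ₛ A *ₛ (B *ₛ C)
  *ₛ-assoc A B C zero    = *-assoc (A 0) (B 0) (C 0)
  *ₛ-assoc A B C (suc n) = begin
    -- By definition the tail of A *ₛ B is A₀ · tail B + tail A *ₛ B.
    A 0 * B 0 * C (suc n) + ((scale (A 0) (tail B) +ₛ tail A *ₛ B) *ₛ C) n
      ≈⟨ +-cong (*-assoc _ _ _) (*ₛ-distribʳ C (scale (A 0) (tail B)) (tail A *ₛ B) n) ⟩
    A 0 * (B 0 * C (suc n)) + ((scale (A 0) (tail B) *ₛ C) n + ((tail A *ₛ B) *ₛ C) n)
      ≈⟨ +-congˡ (+-cong (scale-*ₛ (A 0) (tail B) C n) (*ₛ-assoc (tail A) B C n)) ⟩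
    A 0 * (B 0 * C (suc n)) + (A 0 * (tail B *ₛ C) n + (tail A *ₛ (B *ₛ C)) n)
      ≈⟨ sym (+-assoc _ _ _) ⟩
    A 0 * (B 0 * C (suc n)) + A 0 * (tail B *ₛ C) n + (tail A *ₛ (B *ₛ C)) n
      ≈⟨ +-congʳ (sym (distribˡ (A 0) _ _)) ⟩
    A 0 * (B *ₛ C) (suc n) + (tail A *ₛ (B *ₛ C)) n ∎

  -- The defining recursion with the factors exchanged: it peels off the head of B instead of that
  -- of A, which is what commutativity needs.
  *ₛ-suc : ∀ A B n → (A *ₛ B) (suc n) ≈ A (suc n) * B 0 + (A *ₛ tail B) n
  *ₛ-suc A B zero    = +-comm _ _
  *ₛ-suc A B (suc n) = begin
    A 0 * B (2 ℕ.+ n) + (tail A *ₛ B) (suc n)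
      ≈⟨ +-congˡ (*ₛ-suc (tail A) B n) ⟩
    A 0 * B (2 ℕ.+ n) + (A (2 ℕ.+ n) * B 0 + (tail A *ₛ tail B) n)
      ≈⟨ sym (+-assoc _ _ _) ⟩
    A 0 * B (2 ℕ.+ n) + A (2 ℕ.+ n) * B 0 + (tail A *ₛ tail B) n
      ≈⟨ +-congʳ (+-comm _ _) ⟩
    A (2 ℕ.+ n) * B 0 + A 0 * B (2 ℕ.+ n) + (tail A *ₛ tail B) n
      ≈⟨ +-assoc _ _ _ ⟩
    A (2 ℕ.+ n) * B 0 + (A *ₛ tail B) (suc n) ∎

  *ₛ-comm : ∀ A B → A *ₛ B ≈ₛ B *ₛ A
  *ₛ-comm A B zero    = *-comm (A 0) (B 0)
  *ₛ-comm A B (suc n) = trans (+-cong (*-comm _ _) (*ₛ-comm (tail A) B n)) (sym (*ₛ-suc B A n))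

  *ₛ-identityˡ : ∀ A → 1ₛ *ₛ A ≈ₛ A
  *ₛ-identityˡ A n = trans (const-*ₛ 1# A n) (*-identityˡ (A n))

  psRing : CommutativeRing 0ℓ 0ℓ
  psRing = record
    { Carrier = PS
    ; _≈_ = _≈ₛ_
    ; _+_ = _+ₛ_
    ; _*_ = _*ₛ_
    ; -_  = -ₛ_
    ; 0#  = 0ₛ
    ; 1#  = 1ₛ
    ; isCommutativeRing = record
      { isRing = record
        { +-isAbelianGroup = record
          { isGroup = record
            { isMonoid = record
              { isSemigroup = record
                { isMagma = record
                  { isEquivalence = record
                    { refl  = λ _ → refl
                    ; sym   = λ p n → sym (p n)
                    ; trans = λ p q n → trans (p n) (q n)
                    }
                  ; ∙-cong = λ p q n → +-cong (p n) (q n)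
                  }
                ; assoc = λ A B C n → +-assoc (A n) (B n) (C n)
                }
              ; identity = (λ A n → +-identityˡ (A n)) , (λ A n → +-identityʳ (A n))
              }
            ; inverse = (λ A n → -‿inverseˡ (A n)) , (λ A n → -‿inverseʳ (A n))
            ; ⁻¹-cong = λ p n → -‿cong (p n)
            }
          ; comm = λ A B n → +-comm (A n) (B n)
          }
        ; *-cong = *ₛ-cong
        ; *-assoc = *ₛ-assoc
        ; *-identity = *ₛ-identityˡ , (λ A n → trans (*ₛ-comm A 1ₛ n) (*ₛ-identityˡ A n))
        ; distrib =
            (λ A B C n → trans (*ₛ-comm A (B +ₛ C) n)
              (trans (*ₛ-distribʳ A B C n) (+-cong (*ₛ-comm B A n) (*ₛ-comm C A n))))
          , *ₛ-distribʳ
        }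
      ; *-comm = *ₛ-comm
      }
    }

  const-cong : ∀ {r s} → r ≈ s → const r ≈ₛ const s
  const-cong p zero    = p
  const-cong p (suc _) = refl

  const-+ : ∀ r s → const (r + s) ≈ₛ const r +ₛ const s
  const-+ r s zero    = refl
  const-+ r s (suc _) = sym (+-identityˡ 0#)

  const-* : ∀ r s → const (r * s) ≈ₛ const r *ₛ const s
  const-* r s zero    = refl
  const-* r s (suc n) = sym (trans (const-*ₛ r (const s) (suc n)) (zeroʳ r))

  const-neg : ∀ r → const (- r) ≈ₛ -ₛ const r
  const-neg r zero    = refl
  const-neg r (suc _) = sym -0#≈0#

  const-0 : const 0# ≈ₛ 0ₛ
  const-0 zero    = refl
  const-0 (suc _) = refl

  shift : PS → PS
  shift A zero    = 0#
  shift A (suc n) = A n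

  var : Carrier → PS
  var r = shift (const r)

  var-*ₛ : ∀ r A → var r *ₛ A ≈ₛ shift (scale r A)
  var-*ₛ r A zero    = zeroˡ (A 0)
  var-*ₛ r A (suc n) = trans (+-congʳ (zeroˡ _)) (trans (+-identityˡ _) (const-*ₛ r A n))

  -- In a product of A i and B j with i + j < p + q one of the factors vanishes. This locates the
  -- lowest power of z in the numerator and hence in the quotient.
  *ₛ-order : ∀ p q {A B} → (∀ i → i ℕ.< p → A i ≈ 0#) → (∀ i → i ℕ.< q → B i ≈ 0#) →
             ∀ n → n ℕ.< p ℕ.+ q → (A *ₛ B) n ≈ 0#
  *ₛ-order zero q a b zero n< = trans (*-congˡ (b 0 n<)) (zeroʳ _)
  *ₛ-order zero q a b (suc n) n< = trans
    (+-cong (trans (*-congˡ (b _ n<)) (zeroʳ _)) (*ₛ-order zero q (λ _ ()) b n (ℕ.<-trans (ℕ.n<1+n n) n<)))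
    (+-identityˡ 0#)
  *ₛ-order (suc p) q a b zero n< = trans (*-congʳ (a 0 (ℕ.s≤s ℕ.z≤n))) (zeroˡ _)
  *ₛ-order (suc p) q a b (suc n) (ℕ.s≤s n<) = trans
    (+-cong (trans (*-congʳ (a 0 (ℕ.s≤s ℕ.z≤n))) (zeroˡ _))
            (*ₛ-order p q (λ i i<p → a (suc i) (ℕ.s≤s i<p)) b n n<))
    (+-identityˡ 0#)

psAlgebra : ℤ-Algebra → ℤ-Algebra
psAlgebra A = record
  { commutativeRing = psRing
  ; κ     = λ i → const (κ i)
  ; κ-+   = λ i j n → trans (const-cong (κ-+ i j) n) (const-+ (κ i) (κ j) n)
  ; κ-*   = λ i j n → trans (const-cong (κ-* i j) n) (const-* (κ i) (κ j) n)
  ; κ-neg = λ i n → trans (const-cong (κ-neg i) n) (const-neg (κ i) n)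
  ; κ-0   = λ n → trans (const-cong κ-0 n) (const-0 n)
  ; κ-1   = const-cong κ-1
  }
  where
  open ℤ-Algebra A
  open PowerSeries commutativeRing

-- Finite sums over letters

module Indicator (A : ℤ-Algebra) where
  open ℤ-Algebra A
  open Sum semiring
  open SetoidReasoning setoid
  open Solver A using (solve; _:=_; _:+_; _:-_)

  neq : ∀ {k} → Fin k → Fin k → Carrier
  neq a b = if does (a Fin.≟ b) then 0# else 1#

  neq-idem : ∀ {k} (a b : Fin k) → neq a b * neq a b ≈ neq a b
  neq-idem a b with a Fin.≟ b
  ... | yes _ = zeroˡ 0#
  ... | no  _ = *-identityˡ 1#

  neq-≢ : ∀ {k} {a b : Fin k} → ¬ a ≡ b → neq a b ≈ 1#
  neq-≢ {a = a} {b} a≢b with a Fin.≟ b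
  ... | yes a≡b = ⊥-elim (a≢b a≡b)
  ... | no  _   = refl

  sum-neq : ∀ {k} (a : Fin k) (f : Fin k → Carrier) → sum (λ b → neq a b * f b) ≈ sum f - f a
  sum-neq zero f = begin
    0# * f zero + sum (λ b → 1# * f (suc b)) ≈⟨ +-cong (zeroˡ _) (sum-cong-≋ (λ b → *-identityˡ (f (suc b)))) ⟩
    0# + sum (f ∘ suc)                       ≈⟨ +-congʳ (sym (-‿inverseʳ (f zero))) ⟩
    f zero - f zero + sum (f ∘ suc)          ≈⟨ solve 2 (λ x s → x :- x :+ s := x :+ s :- x) refl _ _ ⟩
    f zero + sum (f ∘ suc) - f zero          ∎
  sum-neq (suc a) f = begin
    1# * f zero + sum (λ b → neq a b * f (suc b)) ≈⟨ +-cong (*-identityˡ _) (sum-neq a (f ∘ suc)) ⟩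
    f zero + (sum (f ∘ suc) - f (suc a))          ≈⟨ sym (+-assoc _ _ _) ⟩
    f zero + sum (f ∘ suc) - f (suc a)            ∎

  sum-linear₃ : ∀ {k} (α β γ : Carrier) (f g h : Fin k → Carrier) →
    sum (λ b → α * f b + β * g b + γ * h b) ≈ α * sum f + β * sum g + γ * sum h
  sum-linear₃ α β γ f g h = begin
    sum (λ b → α * f b + β * g b + γ * h b)
      ≈⟨ ∑-distrib-+ (λ b → α * f b + β * g b) (λ b → γ * h b) ⟩
    sum (λ b → α * f b + β * g b) + sum (λ b → γ * h b)
      ≈⟨ +-cong (∑-distrib-+ (λ b → α * f b) (λ b → β * g b)) (sym (*-distribˡ-sum γ h)) ⟩
    sum (λ b → α * f b) + sum (λ b → β * g b) + γ * sum h
      ≈⟨ +-congʳ (+-cong (sym (*-distribˡ-sum α f)) (sym (*-distribˡ-sum β g))) ⟩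
    α * sum f + β * sum g + γ * sum h ∎

-- The elements y c play the role of x_c z, and t c that of y c / (1 + y c).
module Letters (A : ℤ-Algebra) {k : ℕ} (y t : Fin k → ℤ-Algebra.Carrier A)
  (t*[1+y] : ∀ c → ℤ-Algebra._≈_ A (ℤ-Algebra._*_ A (t c) (ℤ-Algebra._+_ A (ℤ-Algebra.1# A) (y c))) (y c))
  where
  open ℤ-Algebra A
  open Sum semiring
  open SetoidReasoning setoid
  open Solver A using (solve; _:=_; _:+_; _:*_; _:-_; :-_; con)
  open Indicator A

  p₁ p₂ T U : Carrier
  p₁ = sum y
  p₂ = sum (λ c → y c * y c)
  T = sum t
  U = sum (λ c → t c * t c)

  y*t : ∀ c → y c * t c ≈ y c - t c
  y*t c = begin
    y c * t c                ≈⟨ solve 2 (λ y t → y :* t := t :* (con 1ℤ :+ y) :- t) refl (y c) (t c) ⟩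
    t c * (κ 1ℤ + y c) - t c ≈⟨ +-congʳ (trans (*-congˡ (+-congʳ κ-1)) (t*[1+y] c)) ⟩
    y c - t c                ∎

  -- 1 - t c serves as the inverse of 1 + y c, so that the transfer equations can be solved in a
  -- ring without division.
  [1-t]*[1+y] : ∀ c → (1# - t c) * (1# + y c) ≈ 1#
  [1-t]*[1+y] c = begin
    (1# - t c) * (1# + y c)        ≈⟨ solve 3 (λ o y t → (o :- t) :* (o :+ y) := o :* (o :+ y) :- t :* (o :+ y)) refl 1# (y c) (t c) ⟩
    1# * (1# + y c) - t c * (1# + y c) ≈⟨ +-cong (*-identityˡ _) (-‿cong (t*[1+y] c)) ⟩
    1# + y c - y c                 ≈⟨ +-assoc _ _ _ ⟩
    1# + (y c - y c)               ≈⟨ +-congˡ (-‿inverseʳ _) ⟩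
    1# + 0#                        ≈⟨ +-identityʳ 1# ⟩
    1#                             ∎

  [1-t]*y : ∀ c → (1# - t c) * y c ≈ t c
  [1-t]*y c = begin
    (1# - t c) * y c        ≈⟨ solve 3 (λ o y t → (o :- t) :* y := o :* y :- y :* t) refl 1# (y c) (t c) ⟩
    1# * y c - y c * t c    ≈⟨ +-cong (*-identityˡ _) (-‿cong (y*t c)) ⟩
    y c - (y c - t c)       ≈⟨ solve 2 (λ y t → y :- (y :- t) := t) refl (y c) (t c) ⟩
    t c                     ∎

  -- N c stands for the generating function of the walks that start at c, with h weighting the last
  -- letter. The hypothesis is N c = y c (h c + ∑ N d), summed over d ≠ c, with the excluded term d
  -- = c added on both sides.
  module Walks (h N : Fin k → Carrier)
               (N-step : ∀ c → (1# + y c) * N c ≈ y c * (h c + sum N)) where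

    N≈t : ∀ c → N c ≈ t c * (h c + sum N)
    N≈t c = begin
      N c                               ≈⟨ sym (*-identityˡ _) ⟩
      1# * N c                          ≈⟨ *-congʳ (sym ([1-t]*[1+y] c)) ⟩
      (1# - t c) * (1# + y c) * N c     ≈⟨ *-assoc _ _ _ ⟩
      (1# - t c) * ((1# + y c) * N c)   ≈⟨ *-congˡ (N-step c) ⟩
      (1# - t c) * (y c * (h c + sum N)) ≈⟨ sym (*-assoc _ _ _) ⟩
      (1# - t c) * y c * (h c + sum N)  ≈⟨ *-congʳ ([1-t]*y c) ⟩
      t c * (h c + sum N)               ∎

    H : Carrier
    H = sum (λ c → h c * t c)

    sum-N : sum N ≈ H + T * sum N
    sum-N = begin
      sum N                                     ≈⟨ sum-cong-≋ (λ c → trans (N≈t c) (solve 3 (λ t h s → t :* (h :+ s) := h :* t :+ t :* s) refl (t c) (h c) (sum N))) ⟩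
      sum (λ c → h c * t c + t c * sum N)       ≈⟨ ∑-distrib-+ (λ c → h c * t c) (λ c → t c * sum N) ⟩
      H + sum (λ c → t c * sum N)               ≈⟨ +-congˡ (sym (*-distribʳ-sum (sum N) t)) ⟩
      H + T * sum N                             ∎

    sum-h*N : (∀ c → h c * h c ≈ h c) → sum (λ c → h c * N c) ≈ H + H * sum N
    sum-h*N h-idem = begin
      sum (λ c → h c * N c)                       ≈⟨ sum-cong-≋ step ⟩
      sum (λ c → h c * t c + h c * t c * sum N)   ≈⟨ ∑-distrib-+ (λ c → h c * t c) (λ c → h c * t c * sum N) ⟩
      H + sum (λ c → h c * t c * sum N)           ≈⟨ +-congˡ (sym (*-distribʳ-sum (sum N) (λ c → h c * t c))) ⟩
      H + H * sum N                               ∎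
      where
      step : ∀ c → h c * N c ≈ h c * t c + h c * t c * sum N
      step c = begin
        h c * N c                             ≈⟨ *-congˡ (N≈t c) ⟩
        h c * (t c * (h c + sum N))           ≈⟨ solve 3 (λ t h s → h :* (t :* (h :+ s)) := h :* h :* t :+ h :* t :* s) refl (t c) (h c) (sum N) ⟩
        h c * h c * t c + h c * t c * sum N   ≈⟨ +-congʳ (*-congʳ (h-idem c)) ⟩
        h c * t c + h c * t c * sum N         ∎

    -- Since (1 - T) ∑ N = H, weighting the first letter by h as well gives H + H² / (1 - T) for the
    -- walks. Idempotence turns the term h c * h c * t c, where one letter is both ends, into h c *
    -- t c.
    [1-T]*walks : (∀ c → h c * h c ≈ h c) → (1# - T) * sum (λ c → h c * N c) ≈ H * (1# - T + H)
    [1-T]*walks h-idem = begin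
      (1# - T) * sum (λ c → h c * N c) ≈⟨ *-congˡ (sum-h*N h-idem) ⟩
      (1# - T) * (H + H * sum N)       ≈⟨ solve 4 (λ o T H S → (o :- T) :* (H :+ H :* S) := H :* (o :- T) :+ H :* (o :* S :- T :* S)) refl 1# T H (sum N) ⟩
      H * (1# - T) + H * (1# * sum N - T * sum N) ≈⟨ +-congˡ (*-congˡ (+-congʳ (trans (*-identityˡ _) sum-N))) ⟩
      H * (1# - T) + H * (H + T * sum N - T * sum N) ≈⟨ solve 4 (λ o T H S → H :* (o :- T) :+ H :* (H :+ T :* S :- T :* S) := H :* (o :- T :+ H)) refl 1# T H (sum N) ⟩
      H * (1# - T + H) ∎

  weight : Fin k → Fin k → Carrier
  weight a b = (T - t a - t b) * (1# - t a - t b)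

  private
    -- Mixed monomials in the expansion of `y a * y b * weight a b`. Repeated use of y t = y - t
    -- reduces their sums W, V, Y, Z to p₁, p₂, T and U.
    w v : Fin k → Carrier
    w c = y c * t c
    v c = y c * t c * t c

    W V Y Z : Carrier
    W = sum w
    V = sum v
    Y = sum (λ c → y c * y c * t c)
    Z = sum (λ c → y c * y c * t c * t c)

    sum-sub : (f g : Fin k → Carrier) → sum (λ c → f c - g c) ≈ sum f - sum g
    sum-sub f g = begin
      sum (λ c → f c - g c)            ≈⟨ sum-cong-≋ (λ c → solve 2 (λ f g → f :- g := con 1ℤ :* f :+ con (ℤ.- 1ℤ) :* g :+ con 0ℤ :* g) refl (f c) (g c)) ⟩
      sum (λ c → κ 1ℤ * f c + κ (ℤ.- 1ℤ) * g c + κ 0ℤ * g c) ≈⟨ sum-linear₃ _ _ _ f g g ⟩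
      κ 1ℤ * sum f + κ (ℤ.- 1ℤ) * sum g + κ 0ℤ * sum g ≈⟨ solve 2 (λ f g → con 1ℤ :* f :+ con (ℤ.- 1ℤ) :* g :+ con 0ℤ :* g := f :- g) refl _ _ ⟩
      sum f - sum g ∎

    W≈ : W ≈ p₁ - T
    W≈ = trans (sum-cong-≋ y*t) (sum-sub y t)

    V≈ : V ≈ p₁ - T - U
    V≈ = trans (sum-cong-≋ (λ c → trans (*-congʳ (y*t c))
           (solve 2 (λ y t → (y :- t) :* t := y :* t :- t :* t) refl (y c) (t c))))
           (trans (sum-sub w (λ c → t c * t c)) (+-congʳ W≈))

    Y≈ : Y ≈ p₂ - (p₁ - T)
    Y≈ = trans (sum-cong-≋ (λ c → trans (*-assoc _ _ _) (trans (*-congˡ (y*t c))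
           (solve 2 (λ y t → y :* (y :- t) := y :* y :- y :* t) refl (y c) (t c)))))
           (trans (sum-sub (λ c → y c * y c) w) (+-congˡ (-‿cong W≈)))

    Z≈ : Z ≈ p₂ - (p₁ - T) - (p₁ - T - U)
    Z≈ = trans (sum-cong-≋ (λ c →
           trans (solve 2 (λ y t → y :* y :* t :* t := y :* t :* (y :* t)) refl (y c) (t c))
           (trans (*-congˡ (y*t c))
           (solve 2 (λ y t → y :* t :* (y :- t) := y :* y :* t :- y :* t :* t) refl (y c) (t c)))))
           (trans (sum-sub (λ c → y c * y c * t c) v) (+-cong Y≈ (-‿cong V≈)))

    all-pairs : sum (λ a → sum (λ b → y a * y b * weight a b))
      ≈ (T * p₁ - (T + 1#) * W + V) * p₁ + (κ (+ 2) * W - (T + 1#) * p₁) * W + p₁ * V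
    all-pairs = begin
      sum (λ a → sum (λ b → y a * y b * weight a b))
        -- The summand is bilinear in the vectors (y, w, v) at a and at b, so the double sum
        -- factors: b is summed first, with a fixed, and then a. The unit enters the solver as an
        -- opaque variable o, since the constant 1 of the solver is `κ 1ℤ` rather than `1#`.
        ≈⟨ sum-cong-≋ (λ a → trans (sum-cong-≋ (λ b →
             solve 6 (λ o T ya ta yb tb →
               ya :* yb :* ((T :- ta :- tb) :* (o :- ta :- tb))
               := (T :* ya :* o :- (T :+ o) :* (ya :* ta) :+ ya :* ta :* ta) :* yb
                  :+ (con (+ 2) :* (ya :* ta) :- (T :+ o) :* ya) :* (yb :* tb) :+ ya :* (yb :* tb :* tb))
               refl 1# T (y a) (t a) (y b) (t b)))
             (sum-linear₃ _ _ _ y w v)) ⟩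
      sum (λ a → (T * y a * 1# - (T + 1#) * w a + v a) * p₁ + (κ (+ 2) * w a - (T + 1#) * y a) * W + y a * V)
        ≈⟨ sum-cong-≋ (λ a →
             solve 9 (λ o T y w v p W V s →
               (T :* y :* o :- s :* w :+ v) :* p :+ (con (+ 2) :* w :- s :* y) :* W :+ y :* V
               := (T :* p :* o :- s :* W :+ V) :* y :+ (con (+ 2) :* W :- s :* p) :* w :+ p :* v)
               refl 1# T (y a) (w a) (v a) p₁ W V (T + 1#)) ⟩
      sum (λ a → (T * p₁ * 1# - (T + 1#) * W + V) * y a + (κ (+ 2) * W - (T + 1#) * p₁) * w a + p₁ * v a)
        ≈⟨ sum-linear₃ _ _ _ y w v ⟩
      (T * p₁ * 1# - (T + 1#) * W + V) * p₁ + (κ (+ 2) * W - (T + 1#) * p₁) * W + p₁ * V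
        ≈⟨ +-congʳ (+-congʳ (*-congʳ (+-congʳ (+-congʳ (*-identityʳ _))))) ⟩
      (T * p₁ - (T + 1#) * W + V) * p₁ + (κ (+ 2) * W - (T + 1#) * p₁) * W + p₁ * V ∎

    diagonal : sum (λ a → y a * y a * weight a a) ≈ T * p₂ + (- (κ (+ 2) * (T + 1#))) * Y + κ (+ 4) * Z
    diagonal = trans (sum-cong-≋ (λ a →
        trans (solve 4 (λ o T y t → y :* y :* ((T :- t :- t) :* (o :- t :- t))
          := T :* o :* (y :* y) :+ (:- (con (+ 2) :* (T :+ o))) :* (y :* y :* t) :+ con (+ 4) :* (y :* y :* t :* t))
          refl 1# T (y a) (t a))
          (+-congʳ (+-congʳ (*-congʳ (*-identityʳ T))))))
      (sum-linear₃ _ _ _ (λ c → y c * y c) (λ c → y c * y c * t c) (λ c → y c * y c * t c * t c))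

  -- All pairs minus the diagonal. The terms are grouped so that T² occurs only in T² - U and p₂
  -- only in p₁² - p₂: the first becomes (θ² - θ)E after multiplication by E, and the second is
  -- 2e₂z².
  pairs : sum (λ a → sum (λ b → neq a b * (y a * y b * weight a b)))
    ≈ T * (p₂ - p₁ * p₁) + κ (+ 2) * (p₁ * p₁ - p₂) + (κ (+ 2) * p₁ + κ (+ 4)) * (T * T - U)
      + κ (+ 6) * (p₁ - T - p₁ * T)
  pairs = begin
    sum (λ a → sum (λ b → neq a b * (y a * y b * weight a b)))
      ≈⟨ sum-cong-≋ (λ a → sum-neq a (λ b → y a * y b * weight a b)) ⟩
    sum (λ a → sum (λ b → y a * y b * weight a b) - y a * y a * weight a a)
      ≈⟨ sum-sub (λ a → sum (λ b → y a * y b * weight a b)) (λ a → y a * y a * weight a a) ⟩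
    sum (λ a → sum (λ b → y a * y b * weight a b)) - sum (λ a → y a * y a * weight a a)
      ≈⟨ +-cong all-pairs (-‿cong diagonal) ⟩
    (T * p₁ - (T + 1#) * W + V) * p₁ + (κ (+ 2) * W - (T + 1#) * p₁) * W + p₁ * V
      - (T * p₂ + (- (κ (+ 2) * (T + 1#))) * Y + κ (+ 4) * Z)
      ≈⟨ +-cong
           (+-cong (+-cong
             (*-congʳ (+-cong (+-congˡ (-‿cong (*-cong (+-congˡ (sym κ-1)) W≈))) V≈))
             (*-cong (+-cong (*-congˡ W≈) (-‿cong (*-congʳ (+-congˡ (sym κ-1))))) W≈))
             (*-congˡ V≈))
           (-‿cong (+-cong (+-congˡ (*-cong (-‿cong (*-congˡ (+-congˡ (sym κ-1)))) Y≈)) (*-congˡ Z≈))) ⟩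
    (T * p₁ - (T + κ 1ℤ) * (p₁ - T) + (p₁ - T - U)) * p₁
      + (κ (+ 2) * (p₁ - T) - (T + κ 1ℤ) * p₁) * (p₁ - T) + p₁ * (p₁ - T - U)
      - (T * p₂ + (- (κ (+ 2) * (T + κ 1ℤ))) * (p₂ - (p₁ - T)) + κ (+ 4) * (p₂ - (p₁ - T) - (p₁ - T - U)))
      ≈⟨ solve 4 (λ T U p q →
           (T :* p :- (T :+ con 1ℤ) :* (p :- T) :+ (p :- T :- U)) :* p
             :+ (con (+ 2) :* (p :- T) :- (T :+ con 1ℤ) :* p) :* (p :- T) :+ p :* (p :- T :- U)
             :- (T :* q :+ (:- (con (+ 2) :* (T :+ con 1ℤ))) :* (q :- (p :- T)) :+ con (+ 4) :* (q :- (p :- T) :- (p :- T :- U)))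
           := T :* (q :- p :* p) :+ con (+ 2) :* (p :* p :- q) :+ (con (+ 2) :* p :+ con (+ 4)) :* (T :* T :- U)
              :+ con (+ 6) :* (p :- T :- p :* T))
           refl T U p₁ p₂ ⟩
    T * (p₂ - p₁ * p₁) + κ (+ 2) * (p₁ * p₁ - p₂) + (κ (+ 2) * p₁ + κ (+ 4)) * (T * T - U)
      + κ (+ 6) * (p₁ - T - p₁ * T) ∎

-- Elementary symmetric functions as a product in z

module Elementary (R : ℤ-Algebra) where
  open ℤ-Algebra R
  open PowerSeries commutativeRing public

  S : ℤ-Algebra
  S = psAlgebra R

  module S where
    open ℤ-Algebra S public
    open Sum (ℤ-Algebra.semiring S) public

  open Solver R using (solve; _:=_; _:+_; _:*_; _:-_; con)
  module SolveS = Solver S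

  θ : PS → PS
  θ A n = κ (+ n) * A n

  κ-suc : ∀ n → κ (+ suc n) ≈ 1# + κ (+ n)
  κ-suc n = trans (κ-+ 1ℤ (+ n)) (+-congʳ κ-1)

  1+var : Carrier → PS
  1+var r = 1ₛ +ₛ var r

  1+var-*ₛ : ∀ r A → 1+var r *ₛ A ≈ₛ A +ₛ shift (scale r A)
  1+var-*ₛ r A = S.trans (S.distribʳ A 1ₛ (var r)) (S.+-cong (S.*-identityˡ A) (var-*ₛ r A))

  θ-cong : ∀ {A B} → A ≈ₛ B → θ A ≈ₛ θ B
  θ-cong p n = *-congˡ (p n)

  θ-+ : ∀ A B → θ (A +ₛ B) ≈ₛ θ A +ₛ θ B
  θ-+ A B n = distribˡ _ _ _

  θ-var : ∀ r A → θ (var r *ₛ A) ≈ₛ var r *ₛ (A +ₛ θ A)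
  θ-var r A n = trans (*-congˡ (var-*ₛ r A n)) (trans (shifted n) (sym (var-*ₛ r (A +ₛ θ A) n)))
    where
    shifted : ∀ n → κ (+ n) * shift (scale r A) n ≈ shift (scale r (A +ₛ θ A)) n
    shifted zero    = zeroʳ _
    shifted (suc n) = trans (*-congʳ (κ-suc n))
      (trans (solve 4 (λ o s r a → (o :+ s) :* (r :* a) := r :* (o :* a :+ s :* a)) refl 1# (κ (+ n)) r (A n))
             (*-congˡ (+-congʳ (*-identityˡ _))))

  θ-1+var : ∀ r A → θ (1+var r *ₛ A) ≈ₛ 1+var r *ₛ θ A +ₛ var r *ₛ A
  θ-1+var r A = begin
    θ (1+var r *ₛ A)               ≈⟨ θ-cong (S.trans (S.distribʳ A 1ₛ (var r)) (S.+-congʳ (S.*-identityˡ A))) ⟩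
    θ (A +ₛ var r *ₛ A)            ≈⟨ θ-+ A (var r *ₛ A) ⟩
    θ A +ₛ θ (var r *ₛ A)          ≈⟨ S.+-cong (S.sym (S.*-identityˡ (θ A))) (θ-var r A) ⟩
    1ₛ *ₛ θ A +ₛ var r *ₛ (A +ₛ θ A)
      ≈⟨ solve′ 4 (λ o y a b → o :*′ b :+′ y :*′ (a :+′ b) :=′ (o :+′ y) :*′ b :+′ y :*′ a) S.refl 1ₛ (var r) A (θ A) ⟩
    1+var r *ₛ θ A +ₛ var r *ₛ A   ∎
    where
    open SetoidReasoning S.setoid
    open SolveS using () renaming (solve to solve′; _:*_ to _:*′_; _:+_ to _:+′_; _:=_ to _:=′_)

  -- r z / (1 + r z)
  geo : Carrier → PS
  geo r zero    = 0#
  geo r (suc n) = const r n - r * geo r n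

  geo-1+var : ∀ r → geo r *ₛ 1+var r ≈ₛ var r
  geo-1+var r n = trans (S.*-comm (geo r) (1+var r) n) (trans (1+var-*ₛ r (geo r) n) (cancel n))
    where
    cancel : ∀ n → geo r n + shift (scale r (geo r)) n ≈ var r n
    cancel zero    = +-identityˡ 0#
    cancel (suc n) = solve 2 (λ a b → a :- b :+ b := a) refl (const r n) (r * geo r n)

  E : ∀ {k} → (Fin k → Carrier) → PS
  E {zero}  x = 1ₛ
  E {suc k} x = 1+var (x zero) *ₛ E (x ∘ suc)

  T U : ∀ {k} → (Fin k → Carrier) → PS
  T x = S.sum (geo ∘ x)
  U x = S.sum (λ c → geo (x c) *ₛ geo (x c))

  θ₂ : PS → PS
  θ₂ A = θ (θ A) S.- θ A

  -- Logarithmic derivative: the factor 1 + r z contributes r z / (1 + r z) = `geo r`, used in the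
  -- division-free form `geo-1+var`.
  θE : ∀ {k} (x : Fin k → Carrier) → θ (E x) ≈ₛ E x *ₛ T x
  θE {zero}  x zero    = trans (*-congʳ κ-0) (trans (zeroˡ _) (sym (zeroʳ _)))
  θE {zero}  x (suc n) = trans (zeroʳ _) (sym (S.zeroʳ 1ₛ (suc n)))
  θE {suc k} x = begin
    θ (1+var r *ₛ E′)                               ≈⟨ θ-1+var r E′ ⟩
    1+var r *ₛ θ E′ +ₛ var r *ₛ E′                  ≈⟨ S.+-cong (S.*-congˡ {1+var r} (θE (x ∘ suc))) (S.*-congʳ {E′} (S.sym (geo-1+var r))) ⟩
    1+var r *ₛ (E′ *ₛ T′) +ₛ geo r *ₛ 1+var r *ₛ E′ ≈⟨ solve′ 4 (λ l e t g → l :*′ (e :*′ t) :+′ g :*′ l :*′ e :=′ l :*′ e :*′ (g :+′ t)) S.refl (1+var r) E′ T′ (geo r) ⟩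
    1+var r *ₛ E′ *ₛ (geo r +ₛ T′)                  ∎
    where
    open SetoidReasoning S.setoid
    open SolveS using () renaming (solve to solve′; _:*_ to _:*′_; _:+_ to _:+′_; _:=_ to _:=′_)
    r = x zero
    E′ = E (x ∘ suc)
    T′ = T (x ∘ suc)

  -- θ² - θ is z² d²/dz². Each factor of E is linear in z, so only the derivatives of two different
  -- factors survive, with weight ∑ t_c t_d over c ≠ d, which is T² - U.
  θ₂E : ∀ {k} (x : Fin k → Carrier) → θ₂ (E x) ≈ₛ E x *ₛ (T x *ₛ T x S.- U x)
  θ₂E {zero}  x n = trans (flat n)
    (sym (trans (S.*-identityˡ (0ₛ *ₛ 0ₛ S.- 0ₛ) n) (trans (+-congʳ (0-*ₛ 0ₛ n)) (-‿inverseʳ 0#))))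
    where
    flat : ∀ n → κ (+ n) * (κ (+ n) * 1ₛ n) - κ (+ n) * 1ₛ n ≈ 0#
    flat zero    = trans (solve 1 (λ o → con 0ℤ :* (con 0ℤ :* o) :- con 0ℤ :* o := con 0ℤ) refl 1#) κ-0
    flat (suc n) = trans (+-cong (trans (*-congˡ (zeroʳ _)) (zeroʳ _)) (-‿cong (zeroʳ _))) (-‿inverseʳ 0#)
  θ₂E {suc k} x = begin
    θ (θ (l *ₛ E′)) S.- θ (l *ₛ E′)
      ≈⟨ S.+-cong (S.trans (θ-cong (θ-1+var r E′)) (S.trans (θ-+ (l *ₛ θ E′) (y *ₛ E′)) (S.+-cong (θ-1+var r (θ E′)) (θ-var r E′))))
                  (S.-‿cong (θ-1+var r E′)) ⟩
    (l *ₛ θ (θ E′) +ₛ y *ₛ θ E′ +ₛ y *ₛ (E′ +ₛ θ E′)) S.- (l *ₛ θ E′ +ₛ y *ₛ E′)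
      ≈⟨ solve′ 5 (λ l y e f g → (l :*′ g :+′ y :*′ f :+′ y :*′ (e :+′ f)) :-′ (l :*′ f :+′ y :*′ e)
                    :=′ l :*′ (g :-′ f) :+′ y :*′ (f :+′ f)) S.refl l y E′ (θ E′) (θ (θ E′)) ⟩
    l *ₛ θ₂ E′ +ₛ y *ₛ (θ E′ +ₛ θ E′)
      ≈⟨ S.+-cong (S.*-congˡ {l} (θ₂E (x ∘ suc)))
           (S.*-cong (S.sym (geo-1+var r)) (S.+-cong (θE (x ∘ suc)) (θE (x ∘ suc)))) ⟩
    l *ₛ (E′ *ₛ (T′ *ₛ T′ S.- U′)) +ₛ g *ₛ l *ₛ (E′ *ₛ T′ +ₛ E′ *ₛ T′)
      ≈⟨ solve′ 5 (λ l e t u g → l :*′ (e :*′ (t :*′ t :-′ u)) :+′ g :*′ l :*′ (e :*′ t :+′ e :*′ t)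
                    :=′ l :*′ e :*′ ((g :+′ t) :*′ (g :+′ t) :-′ (g :*′ g :+′ u))) S.refl l E′ T′ U′ g ⟩
    l *ₛ E′ *ₛ ((g +ₛ T′) *ₛ (g +ₛ T′) S.- (g *ₛ g +ₛ U′)) ∎
    where
    open SetoidReasoning S.setoid
    open SolveS using () renaming (solve to solve′; _:*_ to _:*′_; _:+_ to _:+′_; _:-_ to _:-′_; _:=_ to _:=′_)
    r = x zero
    l = 1+var r
    y = var r
    g = geo r
    E′ = E (x ∘ suc)
    T′ = T (x ∘ suc)
    U′ = U (x ∘ suc)

  mono : ℕ → Carrier → PS
  mono i r n = if does (n ≟ i) then r else 0#

  mono-cong : ∀ i {r s} → r ≈ s → mono i r ≈ₛ mono i s
  mono-cong i r≈s n with does (n ≟ i)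
  ... | true  = r≈s
  ... | false = refl

  mono-+ : ∀ i r s → mono i (r + s) ≈ₛ mono i r +ₛ mono i s
  mono-+ i r s n with does (n ≟ i)
  ... | true  = refl
  ... | false = sym (+-identityˡ 0#)

  mono-0 : ∀ r → mono 0 r ≈ₛ const r
  mono-0 r zero    = refl
  mono-0 r (suc n) = refl

  var-mono : ∀ i r s → var r *ₛ mono i s ≈ₛ mono (suc i) (r * s)
  var-mono i r s n = trans (var-*ₛ r (mono i s) n) (shifted n)
    where
    shifted : ∀ n → shift (scale r (mono i s)) n ≈ mono (suc i) (r * s) n
    shifted zero = refl
    shifted (suc n) with does (n ≟ i)
    ... | true  = refl
    ... | false = zeroʳ r

  E-suc : ∀ {k} (x : Fin (suc k) → Carrier) n → E x (suc n) ≈ x zero * E (x ∘ suc) n + E (x ∘ suc) (suc n)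
  E-suc x n = trans (1+var-*ₛ (x zero) (E (x ∘ suc)) (suc n)) (+-comm _ _)

  E-0 : ∀ {k} (x : Fin k → Carrier) → E x 0 ≈ 1#
  E-0 {zero}  x = refl
  E-0 {suc k} x = trans (1+var-*ₛ (x zero) (E (x ∘ suc)) 0) (trans (+-identityʳ _) (E-0 (x ∘ suc)))

  Z₁ Z₂ : ∀ {k} → (Fin k → Carrier) → PS
  Z₁ x = mono 1 (E x 1)
  Z₂ x = mono 2 (E x 2)

  mono-zero : ∀ i → mono i 0# ≈ₛ 0ₛ
  mono-zero i n with does (n ≟ i)
  ... | true  = refl
  ... | false = refl

  Z₁-sum : ∀ {k} (x : Fin k → Carrier) → S.sum (var ∘ x) ≈ₛ Z₁ x
  Z₁-sum {zero}  x = S.sym (mono-zero 1)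
  Z₁-sum {suc k} x = S.sym (S.trans (mono-cong 1 (E-suc x 0))
    (S.trans (mono-+ 1 (x zero * E (x ∘ suc) 0) (E (x ∘ suc) 1))
    (S.+-cong
      (S.trans (S.sym (var-mono 0 (x zero) (E (x ∘ suc) 0)))
        (S.trans (S.*-congˡ {var (x zero)} (S.trans (mono-cong 0 (E-0 (x ∘ suc))) (mono-0 1#))) (S.*-identityʳ (var (x zero)))))
      (S.sym (Z₁-sum (x ∘ suc))))))

  -- Newton's identity p₁² - p₂ = 2e₂: a new letter y adds 2 y e₁ on the left, and y e₁ is what it
  -- adds to e₂.
  Z₂-sum : ∀ {k} (x : Fin k → Carrier) →
    Z₁ x *ₛ Z₁ x S.- S.sum (λ c → var (x c) *ₛ var (x c)) ≈ₛ S.κ (+ 2) *ₛ Z₂ x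
  Z₂-sum {zero}  x = S.trans
    (S.+-congʳ (S.trans (S.*-congʳ {Z₁ x} (mono-zero 1)) (0-*ₛ (Z₁ x))))
    (S.trans (S.-‿inverseʳ 0ₛ) (S.sym (S.trans (S.*-congˡ {S.κ (+ 2)} (mono-zero 2)) (S.zeroʳ (S.κ (+ 2))))))
  Z₂-sum {suc k} x = begin
    Z₁ x *ₛ Z₁ x S.- (y *ₛ y +ₛ P′)
      ≈⟨ S.+-congʳ (S.*-cong Z₁-step Z₁-step) ⟩
    (y +ₛ Z₁ (x ∘ suc)) *ₛ (y +ₛ Z₁ (x ∘ suc)) S.- (y *ₛ y +ₛ P′)
      ≈⟨ solve′ 3 (λ y z p → (y :+′ z) :*′ (y :+′ z) :-′ (y :*′ y :+′ p)
                    :=′ con′ (+ 2) :*′ (y :*′ z) :+′ (z :*′ z :-′ p)) S.refl y (Z₁ (x ∘ suc)) P′ ⟩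
    S.κ (+ 2) *ₛ (y *ₛ Z₁ (x ∘ suc)) +ₛ (Z₁ (x ∘ suc) *ₛ Z₁ (x ∘ suc) S.- P′)
      ≈⟨ S.+-cong (S.*-congˡ {S.κ (+ 2)} (var-mono 1 (x zero) (E (x ∘ suc) 1))) (Z₂-sum (x ∘ suc)) ⟩
    S.κ (+ 2) *ₛ mono 2 (x zero * E (x ∘ suc) 1) +ₛ S.κ (+ 2) *ₛ Z₂ (x ∘ suc)
      ≈⟨ S.sym (S.distribˡ (S.κ (+ 2)) _ _) ⟩
    S.κ (+ 2) *ₛ (mono 2 (x zero * E (x ∘ suc) 1) +ₛ Z₂ (x ∘ suc))
      ≈⟨ S.*-congˡ {S.κ (+ 2)} (S.sym (S.trans (mono-cong 2 (E-suc x 1)) (mono-+ 2 _ _))) ⟩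
    S.κ (+ 2) *ₛ Z₂ x ∎
    where
    open SetoidReasoning S.setoid
    open SolveS using () renaming (solve to solve′; _:*_ to _:*′_; _:+_ to _:+′_; _:-_ to _:-′_; _:=_ to _:=′_; con to con′)
    y = var (x zero)
    P′ = S.sum (λ c → var (x (suc c)) *ₛ var (x (suc c)))
    Z₁-step : Z₁ x ≈ₛ y +ₛ Z₁ (x ∘ suc)
    Z₁-step = S.trans (S.sym (Z₁-sum x)) (S.+-congˡ {y} (Z₁-sum (x ∘ suc)))

  -- The series ∑_{i ≥ m} (c i) eᵢ zⁱ when A is the generating series of the eᵢ.
  from : ℕ → (ℕ → ℤ) → PS → PS
  from m c A n = if does (m ≤? n) then κ (c n) * A n else 0#

-- Coefficient polynomials as combinations of θ² - θ, θ and 1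

cut : ℕ → (ℕ → ℤ) → ℕ → ℤ
cut m c n = if does (m ≤? n) then c n else 0ℤ

δ : ℕ → ℕ → ℤ
δ i n = if does (n ≟ i) then 1ℤ else 0ℤ

f₂ f₃ dᵢ jᵢ : ℕ → ℤ
f₂ i = + 2 · + i · + i ℤ.- + 5 · + i
f₃ i = (+ i ℤ.- + 1) · (+ i ℤ.- + 3)
dᵢ i = + i ℤ.- + 1
jᵢ i = + 2 · + i · + i ℤ.- + 6 · + i +ᶻ + 2

-- The coefficient of eₙ zⁿ in (a (θ² − θ) + b θ + c) E + p + q e₁ z + r e₂ z²;
-- the last three terms correct the indices below the start of a truncated sum.
combination : (a b c p q r : ℤ) → ℕ → ℤ
combination a b c p q r n =
  a · (+ n · + n ℤ.- + n) +ᶻ b · + n +ᶻ c +ᶻ p · δ 0 n +ᶻ q · δ 1 n +ᶻ r · δ 2 n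

-- 2i² - 5i = 2(i² - i) - 3i takes the values 0, -3, -2 at i = 0, 1, 2, and the last three constants
-- cancel these. The constants in the other four lemmas arise in the same way.
f₂-combination : ∀ n → cut 3 f₂ n ≡ combination (+ 2) (ℤ.- + 3) 0ℤ 0ℤ (+ 3) (+ 2) n
f₂-combination 0 = ≡.refl
f₂-combination 1 = ≡.refl
f₂-combination 2 = ≡.refl
f₂-combination (suc (suc (suc n))) = solve 1 (λ i →
    con (+ 2) :* i :* i :- con (+ 5) :* i
    := con (+ 2) :* (i :* i :- i) :+ con (ℤ.- + 3) :* i :+ con 0ℤ :+ con 0ℤ :* con 0ℤ :+ con (+ 3) :* con 0ℤ :+ con (+ 2) :* con 0ℤ)
    ≡.refl (+ suc (suc (suc n)))
  where open ℤSolver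

-- The sum starts at 4 although only the indices 0, 1, 2 can be corrected: `f₃` vanishes at 3.
f₃-combination : ∀ n → cut 4 f₃ n ≡ combination 1ℤ (ℤ.- + 3) (+ 3) (ℤ.- + 3) 0ℤ 1ℤ n
f₃-combination 0 = ≡.refl
f₃-combination 1 = ≡.refl
f₃-combination 2 = ≡.refl
f₃-combination 3 = ≡.refl
f₃-combination (suc (suc (suc (suc n)))) = solve 1 (λ i →
    (i :- con (+ 1)) :* (i :- con (+ 3))
    := con 1ℤ :* (i :* i :- i) :+ con (ℤ.- + 3) :* i :+ con (+ 3) :+ con (ℤ.- + 3) :* con 0ℤ :+ con 0ℤ :* con 0ℤ :+ con 1ℤ :* con 0ℤ)
    ≡.refl (+ suc (suc (suc (suc n))))
  where open ℤSolver

j-combination : ∀ n → cut 3 jᵢ n ≡ combination (+ 2) (ℤ.- + 4) (+ 2) (ℤ.- + 2) (+ 2) (+ 2) n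
j-combination 0 = ≡.refl
j-combination 1 = ≡.refl
j-combination 2 = ≡.refl
j-combination (suc (suc (suc n))) = solve 1 (λ i →
    con (+ 2) :* i :* i :- con (+ 6) :* i :+ con (+ 2)
    := con (+ 2) :* (i :* i :- i) :+ con (ℤ.- + 4) :* i :+ con (+ 2) :+ con (ℤ.- + 2) :* con 0ℤ :+ con (+ 2) :* con 0ℤ :+ con (+ 2) :* con 0ℤ)
    ≡.refl (+ suc (suc (suc n)))
  where open ℤSolver

d-combination₂ : ∀ n → cut 2 dᵢ n ≡ combination 0ℤ 1ℤ (ℤ.- 1ℤ) 1ℤ 0ℤ 0ℤ n
d-combination₂ 0 = ≡.refl
d-combination₂ 1 = ≡.refl
d-combination₂ 2 = ≡.refl
d-combination₂ (suc (suc (suc n))) = solve 1 (λ i →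
    i :- con (+ 1)
    := con 0ℤ :* (i :* i :- i) :+ con 1ℤ :* i :+ con (ℤ.- 1ℤ) :+ con 1ℤ :* con 0ℤ :+ con 0ℤ :* con 0ℤ :+ con 0ℤ :* con 0ℤ)
    ≡.refl (+ suc (suc (suc n)))
  where open ℤSolver

d-combination₃ : ∀ n → cut 3 dᵢ n ≡ combination 0ℤ 1ℤ (ℤ.- 1ℤ) 1ℤ 0ℤ (ℤ.- 1ℤ) n
d-combination₃ 0 = ≡.refl
d-combination₃ 1 = ≡.refl
d-combination₃ 2 = ≡.refl
d-combination₃ (suc (suc (suc n))) = solve 1 (λ i →
    i :- con (+ 1)
    := con 0ℤ :* (i :* i :- i) :+ con 1ℤ :* i :+ con (ℤ.- 1ℤ) :+ con 1ℤ :* con 0ℤ :+ con 0ℤ :* con 0ℤ :+ con (ℤ.- 1ℤ) :* con 0ℤ)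
    ≡.refl (+ suc (suc (suc n)))
  where open ℤSolver

-- The rational form of the series of twinned cycles

module TwinnedCycles (R : ℤ-Algebra) {k : ℕ} (x : Fin k → ℤ-Algebra.Carrier R) where
  open ℤ-Algebra R
  open Elementary R
  open Indicator R using (neq; neq-idem; sum-neq)
  open Sum (ℤ-Algebra.semiring R) using (sum; sum-cong-≋; *-distribˡ-sum)
  module IS = Indicator S
  module L = Letters S (var ∘ x) (geo ∘ x) (geo-1+var ∘ x)

  private
    e : PS
    e = E x

  from-cut : ∀ m c n → from m c e n ≈ κ (cut m c n) * e n
  from-cut m c n with does (m ≤? n)
  ... | true  = refl
  ... | false = sym (trans (*-congʳ κ-0) (zeroˡ (e n)))

  mono-δ : ∀ A i n → mono i (A i) n ≈ κ (δ i n) * A n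
  mono-δ A zero    zero    = sym (trans (*-congʳ κ-1) (*-identityˡ (A 0)))
  mono-δ A zero    (suc n) = sym (trans (*-congʳ κ-0) (zeroˡ (A (suc n))))
  mono-δ A (suc i) zero    = sym (trans (*-congʳ κ-0) (zeroˡ (A 0)))
  mono-δ A (suc i) (suc n) = mono-δ (tail A) i n

  -- Multiplying the n-th coefficient by n is applying θ, so a quadratic polynomial in n acts on e
  -- as a differential operator. The correction at index 0 is a bare constant because e₀ = 1.
  from-combination : ∀ m c (a b c′ p q r : ℤ) → (∀ n → cut m c n ≡ combination a b c′ p q r n) →
    from m c e ≈ₛ S.κ a *ₛ θ₂ e +ₛ S.κ b *ₛ θ e +ₛ S.κ c′ *ₛ e +ₛ S.κ p +ₛ S.κ q *ₛ Z₁ x +ₛ S.κ r *ₛ Z₂ x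
  from-combination m c a b c′ p q r eq n = begin
    from m c e n                                   ≈⟨ from-cut m c n ⟩
    κ (cut m c n) * e n                            ≈⟨ *-congʳ (reflexive (≡.cong κ (eq n))) ⟩
    κ (combination a b c′ p q r n) * e n
      ≈⟨ *-congʳ (κ+ (κ+ (κ+ (κ+ (κ+ (κ* (κ+ (κ-* _ _) (κ-neg _))) (κ-* _ _)) refl) (κ-* _ _)) (κ-* _ _)) (κ-* _ _)) ⟩
    (κ a * (s * s - s) + κ b * s + κ c′ + κ p * d₀ + κ q * d₁ + κ r * d₂) * e n
      ≈⟨ solve 11 (λ a b c p q r s d₀ d₁ d₂ e →
           (a :* (s :* s :- s) :+ b :* s :+ c :+ p :* d₀ :+ q :* d₁ :+ r :* d₂) :* e
           := a :* (s :* (s :* e) :- s :* e) :+ b :* (s :* e) :+ c :* e :+ p :* (d₀ :* e) :+ q :* (d₁ :* e) :+ r :* (d₂ :* e))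
           refl (κ a) (κ b) (κ c′) (κ p) (κ q) (κ r) s d₀ d₁ d₂ (e n) ⟩
    κ a * (s * (s * e n) - s * e n) + κ b * (s * e n) + κ c′ * e n + κ p * (d₀ * e n) + κ q * (d₁ * e n) + κ r * (d₂ * e n)
      ≈⟨ +-cong (+-cong (+-cong (+-cong (+-cong
           (sym (const-*ₛ _ (θ₂ e) n)) (sym (const-*ₛ _ (θ e) n))) (sym (const-*ₛ _ e n)))
           (constant n)) (trans (*-congˡ (sym (mono-δ e 1 n))) (sym (const-*ₛ _ (Z₁ x) n))))
           (trans (*-congˡ (sym (mono-δ e 2 n))) (sym (const-*ₛ _ (Z₂ x) n))) ⟩
    (S.κ a *ₛ θ₂ e +ₛ S.κ b *ₛ θ e +ₛ S.κ c′ *ₛ e +ₛ S.κ p +ₛ S.κ q *ₛ Z₁ x +ₛ S.κ r *ₛ Z₂ x) n ∎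
    where
    open SetoidReasoning setoid
    open Solver R using (solve; _:=_; _:+_; _:*_; _:-_)
    s = κ (+ n)
    d₀ = κ (δ 0 n)
    d₁ = κ (δ 1 n)
    d₂ = κ (δ 2 n)
    κ+ : ∀ {i j u v} → κ i ≈ u → κ j ≈ v → κ (i +ᶻ j) ≈ u + v
    κ+ p q = trans (κ-+ _ _) (+-cong p q)
    κ* : ∀ {i j v} → κ j ≈ v → κ (i · j) ≈ κ i * v
    κ* q = trans (κ-* _ _) (*-congˡ q)
    constant : ∀ n → κ p * (κ (δ 0 n) * e n) ≈ const (κ p) n
    constant zero    = trans (*-congˡ (trans (*-congʳ κ-1) (trans (*-identityˡ _) (E-0 x)))) (*-identityʳ _)
    constant (suc n) = trans (*-congˡ (trans (*-congʳ κ-0) (zeroˡ _))) (zeroʳ _)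

  F₂ F₃ D₂ D₃ J numerator : PS
  F₂ = from 3 f₂ e
  F₃ = from 4 f₃ e
  D₂ = from 2 dᵢ e
  D₃ = from 3 dᵢ e
  J  = from 3 jᵢ e
  numerator = Z₁ x *ₛ F₃ +ₛ F₂ *ₛ D₃ +ₛ Z₂ x *ₛ J

  open SolveS using (solve; _:=_; _:+_; _:*_; _:-_; con)

  denominator-E : 1ₛ S.- D₂ ≈ₛ e *ₛ (1ₛ S.- T x)
  denominator-E = begin
    1ₛ S.- D₂
      ≈⟨ S.+-cong (S.sym S.κ-1) (S.-‿cong (from-combination 2 dᵢ 0ℤ 1ℤ (ℤ.- 1ℤ) 1ℤ 0ℤ 0ℤ d-combination₂)) ⟩
    S.κ 1ℤ S.- (S.κ 0ℤ *ₛ θ₂ e +ₛ S.κ 1ℤ *ₛ θ e +ₛ S.κ (ℤ.- 1ℤ) *ₛ e +ₛ S.κ 1ℤ +ₛ S.κ 0ℤ *ₛ Z₁ x +ₛ S.κ 0ℤ *ₛ Z₂ x)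
      ≈⟨ solve 5 (λ g f e z₁ z₂ → con 1ℤ :- (con 0ℤ :* g :+ con 1ℤ :* f :+ con (ℤ.- 1ℤ) :* e :+ con 1ℤ :+ con 0ℤ :* z₁ :+ con 0ℤ :* z₂)
           := e :* con 1ℤ :- f) S.refl (θ₂ e) (θ e) e (Z₁ x) (Z₂ x) ⟩
    e *ₛ S.κ 1ℤ S.- θ e
      ≈⟨ S.+-cong (S.*-congˡ {e} S.κ-1) (S.-‿cong (θE x)) ⟩
    e *ₛ 1ₛ S.- e *ₛ T x
      ≈⟨ solve 3 (λ e o t → e :* o :- e :* t := e :* (o :- t)) S.refl e 1ₛ (T x) ⟩
    e *ₛ (1ₛ S.- T x) ∎
    where open SetoidReasoning S.setoid

  -- Multiplication by e removes T and U altogether: e T is θe and e (T² - U) is (θ² - θ)e. What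
  -- remains is a polynomial identity in e, θe, (θ² - θ)e, e₁z and e₂z².
  pairs-E : e *ₛ S.sum (λ a → S.sum (λ b → IS.neq a b *ₛ (var (x a) *ₛ var (x b) *ₛ L.weight a b)))
    ≈ₛ S.κ (+ 2) *ₛ (F₂ *ₛ (1ₛ S.- D₂) +ₛ numerator)
  pairs-E = begin
    e *ₛ S.sum (λ a → S.sum (λ b → IS.neq a b *ₛ (var (x a) *ₛ var (x b) *ₛ L.weight a b)))
      ≈⟨ S.*-congˡ {e} L.pairs ⟩
    e *ₛ (T x *ₛ (L.p₂ S.- L.p₁ *ₛ L.p₁) +ₛ κ₂ *ₛ (L.p₁ *ₛ L.p₁ S.- L.p₂)
           +ₛ (κ₂ *ₛ L.p₁ +ₛ κ₄) *ₛ (T x *ₛ T x S.- U x) +ₛ κ₆ *ₛ (L.p₁ S.- T x S.- L.p₁ *ₛ T x))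
      ≈⟨ solve 7 (λ e t p q u κ₄ κ₆ →
           e :* (t :* (q :- p :* p) :+ con (+ 2) :* (p :* p :- q) :+ (con (+ 2) :* p :+ κ₄) :* (t :* t :- u) :+ κ₆ :* (p :- t :- p :* t))
           := (con (+ 2) :* e :- e :* t) :* (p :* p :- q) :+ (con (+ 2) :* p :+ κ₄) :* (e :* (t :* t :- u))
              :+ κ₆ :* (p :* e :- e :* t :- p :* (e :* t)))
           S.refl e (T x) L.p₁ L.p₂ (U x) κ₄ κ₆ ⟩
    (κ₂ *ₛ e S.- e *ₛ T x) *ₛ (L.p₁ *ₛ L.p₁ S.- L.p₂) +ₛ (κ₂ *ₛ L.p₁ +ₛ κ₄) *ₛ (e *ₛ (T x *ₛ T x S.- U x))
      +ₛ κ₆ *ₛ (L.p₁ *ₛ e S.- e *ₛ T x S.- L.p₁ *ₛ (e *ₛ T x))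
      ≈⟨ S.+-cong (S.+-cong
           (S.*-cong (S.+-congˡ {κ₂ *ₛ e} (S.-‿cong eT)) (S.trans (S.+-congʳ (S.*-cong p₁≈ p₁≈)) (Z₂-sum x)))
           (S.*-cong (S.+-congʳ (S.*-congˡ {κ₂} p₁≈)) (S.sym (θ₂E x))))
           (S.*-congˡ {κ₆} (S.+-cong (S.+-cong (S.*-congʳ {e} p₁≈) (S.-‿cong eT)) (S.-‿cong (S.*-cong p₁≈ eT)))) ⟩
    (κ₂ *ₛ e S.- f) *ₛ (κ₂ *ₛ z₂) +ₛ (κ₂ *ₛ z₁ +ₛ κ₄) *ₛ g +ₛ κ₆ *ₛ (z₁ *ₛ e S.- f S.- z₁ *ₛ f)
      -- The products of two infinite series cancel on the right: D₂ and D₃ differ by e₂z², so F₂(1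
      -- - D₂) + F₂D₃ = F₂(1 - e₂z²).
      ≈⟨ solve 5 (λ e f g z₁ z₂ →
           (con (+ 2) :* e :- f) :* (con (+ 2) :* z₂) :+ (con (+ 2) :* z₁ :+ con (+ 4)) :* g :+ con (+ 6) :* (z₁ :* e :- f :- z₁ :* f)
           := con (+ 2) :* (comb e f g z₁ z₂ (+ 2) (ℤ.- + 3) 0ℤ 0ℤ (+ 3) (+ 2) :* (con 1ℤ :- comb e f g z₁ z₂ 0ℤ 1ℤ (ℤ.- 1ℤ) 1ℤ 0ℤ 0ℤ)
               :+ (z₁ :* comb e f g z₁ z₂ 1ℤ (ℤ.- + 3) (+ 3) (ℤ.- + 3) 0ℤ 1ℤ
                   :+ comb e f g z₁ z₂ (+ 2) (ℤ.- + 3) 0ℤ 0ℤ (+ 3) (+ 2) :* comb e f g z₁ z₂ 0ℤ 1ℤ (ℤ.- 1ℤ) 1ℤ 0ℤ (ℤ.- 1ℤ)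
                   :+ z₂ :* comb e f g z₁ z₂ (+ 2) (ℤ.- + 4) (+ 2) (ℤ.- + 2) (+ 2) (+ 2))))
           S.refl e f g z₁ z₂ ⟩
    κ₂ *ₛ (combₛ (+ 2) (ℤ.- + 3) 0ℤ 0ℤ (+ 3) (+ 2) *ₛ (S.κ 1ℤ S.- combₛ 0ℤ 1ℤ (ℤ.- 1ℤ) 1ℤ 0ℤ 0ℤ)
           +ₛ (z₁ *ₛ combₛ 1ℤ (ℤ.- + 3) (+ 3) (ℤ.- + 3) 0ℤ 1ℤ
               +ₛ combₛ (+ 2) (ℤ.- + 3) 0ℤ 0ℤ (+ 3) (+ 2) *ₛ combₛ 0ℤ 1ℤ (ℤ.- 1ℤ) 1ℤ 0ℤ (ℤ.- 1ℤ)
               +ₛ z₂ *ₛ combₛ (+ 2) (ℤ.- + 4) (+ 2) (ℤ.- + 2) (+ 2) (+ 2)))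
      ≈⟨ S.*-congˡ {κ₂} (S.+-cong
           (S.*-cong F₂≈ (S.+-cong S.κ-1 (S.-‿cong (S.sym (from-combination 2 dᵢ _ _ _ _ _ _ d-combination₂)))))
           (S.+-cong (S.+-cong (S.*-congˡ {z₁} (S.sym (from-combination 4 f₃ _ _ _ _ _ _ f₃-combination)))
             (S.*-cong F₂≈ (S.sym (from-combination 3 dᵢ _ _ _ _ _ _ d-combination₃))))
             (S.*-congˡ {z₂} (S.sym (from-combination 3 jᵢ _ _ _ _ _ _ j-combination))))) ⟩
    κ₂ *ₛ (F₂ *ₛ (1ₛ S.- D₂) +ₛ numerator) ∎
    where
    open SetoidReasoning S.setoid
    κ₂ = S.κ (+ 2)
    κ₄ = S.κ (+ 4)
    κ₆ = S.κ (+ 6)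
    z₁ = Z₁ x
    z₂ = Z₂ x
    f = θ e
    g = θ₂ e
    comb : ∀ {m} (e f g z₁ z₂ : SolveS.Polynomial m) (a b c p q r : ℤ) → SolveS.Polynomial m
    comb e f g z₁ z₂ a b c p q r = con a :* g :+ con b :* f :+ con c :* e :+ con p :+ con q :* z₁ :+ con r :* z₂
    combₛ : (a b c p q r : ℤ) → PS
    combₛ a b c p q r = S.κ a *ₛ g +ₛ S.κ b *ₛ f +ₛ S.κ c *ₛ e +ₛ S.κ p +ₛ S.κ q *ₛ z₁ +ₛ S.κ r *ₛ z₂
    p₁≈ : L.p₁ ≈ₛ z₁
    p₁≈ = Z₁-sum x
    eT : e *ₛ T x ≈ₛ f
    eT = S.sym (θE x)
    F₂≈ : combₛ (+ 2) (ℤ.- + 3) 0ℤ 0ℤ (+ 3) (+ 2) ≈ₛ F₂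
    F₂≈ = S.sym (from-combination 3 f₂ _ _ _ _ _ _ f₂-combination)

  module _ (h : Fin k → Carrier) where
    -- m counts steps, so the words have m + 1 letters; hence the `shift` in `walkSeries`.
    walk : ℕ → Fin k → Carrier
    walk zero    c = x c * h c
    walk (suc m) c = x c * sum (λ d → neq c d * walk m d)

    walkSeries : Fin k → PS
    walkSeries c = shift (λ m → walk m c)

  S-sum : ∀ {l} (f : Fin l → PS) n → S.sum f n ≈ sum (λ c → f c n)
  S-sum {zero}  f n = refl
  S-sum {suc l} f n = +-congˡ (S-sum (f ∘ suc) n)

  -- The factor 1 + x_c z adds back the continuation d = c that `neq` leaves out, so that the sum on
  -- the right runs over all letters.
  walkSeries-step : ∀ h c →
    1+var (x c) *ₛ walkSeries h c ≈ₛ var (x c) *ₛ (const (h c) +ₛ S.sum (walkSeries h))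
  walkSeries-step h c n = trans (1+var-*ₛ (x c) (walkSeries h c) n)
    (trans (step n) (sym (var-*ₛ (x c) (const (h c) +ₛ S.sum (walkSeries h)) n)))
    where
    open Solver R using () renaming (solve to solve′; _:=_ to _:=′_; _:+_ to _:+′_; _:*_ to _:*′_; _:-_ to _:-′_)
    step : ∀ n → walkSeries h c n + shift (scale (x c) (walkSeries h c)) n
                 ≈ shift (scale (x c) (const (h c) +ₛ S.sum (walkSeries h))) n
    step zero = +-identityʳ 0#
    step (suc zero) = trans (+-congˡ (zeroʳ (x c))) (trans (+-identityʳ _)
      (*-congˡ (sym (trans (+-congˡ (trans (S-sum (walkSeries h) 0) (zeros k))) (+-identityʳ _)))))
      where
      zeros : ∀ l → sum {l} (λ _ → 0#) ≈ 0#
      zeros zero    = refl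
      zeros (suc l) = trans (+-identityˡ _) (zeros l)
    step (suc (suc m)) = begin
      x c * sum (λ d → neq c d * walk h m d) + x c * walk h m c
        ≈⟨ +-congʳ (*-congˡ (sum-neq c (walk h m))) ⟩
      x c * (sum (walk h m) - walk h m c) + x c * walk h m c
        ≈⟨ solve′ 3 (λ x s w → x :*′ (s :-′ w) :+′ x :*′ w :=′ x :*′ s) refl (x c) (sum (walk h m)) (walk h m c) ⟩
      x c * sum (walk h m)
        ≈⟨ *-congˡ (trans (sym (S-sum (walkSeries h) (suc m))) (sym (+-identityˡ _))) ⟩
      x c * (0# + S.sum (walkSeries h) (suc m)) ∎
      where open SetoidReasoning setoid

  avoid : Fin k → Fin k → Fin k → Carrier
  avoid a b c = neq a c * neq b c

  walksAvoiding : Fin k → Fin k → PS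
  walksAvoiding a b = S.sum (λ c → const (avoid a b c) *ₛ walkSeries (avoid a b) c)

  twinTerm : Fin k → Fin k → PS
  twinTerm a b = IS.neq a b *ₛ (var (x a) *ₛ var (x b) *ₛ walksAvoiding a b)

  twinSeries : PS
  twinSeries = S.sum (λ a → S.sum (twinTerm a))

  neq-const : ∀ {l} (a b : Fin l) → const (neq a b) ≈ₛ IS.neq a b
  neq-const a b with does (a Fin.≟ b)
  ... | true  = const-0
  ... | false = λ _ → refl

  -- The factor `neq` stands on both sides because `weight` is only right for distinct letters: for
  -- a = b the letters avoiding both contribute T - t_a, not T - 2t_a.
  [1-T]*walksAvoiding : ∀ a b → IS.neq a b *ₛ ((1ₛ S.- T x) *ₛ walksAvoiding a b) ≈ₛ IS.neq a b *ₛ L.weight a b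
  [1-T]*walksAvoiding a b with a Fin.≟ b
  ... | yes _   = S.trans (S.zeroˡ ((1ₛ S.- T x) *ₛ walksAvoiding a b)) (S.sym (S.zeroˡ (L.weight a b)))
  ... | no  a≢b = S.*-congˡ {1ₛ} (begin
    (1ₛ S.- T x) *ₛ walksAvoiding a b ≈⟨ W.[1-T]*walks h-idem ⟩
    W.H *ₛ (1ₛ S.- T x +ₛ W.H)        ≈⟨ S.*-cong H≈ (S.+-congˡ {1ₛ S.- T x} H≈) ⟩
    (T x S.- ta S.- tb) *ₛ (1ₛ S.- T x +ₛ (T x S.- ta S.- tb))
      ≈⟨ solve 4 (λ o T a b → (T :- a :- b) :* (o :- T :+ (T :- a :- b)) := (T :- a :- b) :* (o :- a :- b)) S.refl 1ₛ (T x) ta tb ⟩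
    L.weight a b ∎)
    where
    open SetoidReasoning S.setoid
    h : Fin k → PS
    h c = const (avoid a b c)
    module W = L.Walks h (walkSeries (avoid a b)) (walkSeries-step (avoid a b))
    ta = geo (x a)
    tb = geo (x b)
    h≈ : ∀ c → h c ≈ₛ IS.neq a c *ₛ IS.neq b c
    h≈ c = S.trans (const-* (neq a c) (neq b c)) (S.*-cong (neq-const a c) (neq-const b c))
    h-idem : ∀ c → h c *ₛ h c ≈ₛ h c
    h-idem c = S.trans (S.sym (const-* (avoid a b c) (avoid a b c))) (const-cong
      (trans (solve′ 2 (λ p q → p :*′ q :*′ (p :*′ q) :=′ p :*′ p :*′ (q :*′ q)) refl (neq a c) (neq b c))
             (*-cong (neq-idem a c) (neq-idem b c))))
      where open Solver R using () renaming (solve to solve′; _:=_ to _:=′_; _:*_ to _:*′_)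
    H≈ : W.H ≈ₛ T x S.- ta S.- tb
    H≈ = begin
      S.sum (λ c → h c *ₛ geo (x c))
        ≈⟨ S.sum-cong-≋ (λ c → S.trans (S.*-congʳ {geo (x c)} (h≈ c)) (S.*-assoc (IS.neq a c) (IS.neq b c) (geo (x c)))) ⟩
      S.sum (λ c → IS.neq a c *ₛ (IS.neq b c *ₛ geo (x c)))
        ≈⟨ IS.sum-neq a (λ c → IS.neq b c *ₛ geo (x c)) ⟩
      S.sum (λ c → IS.neq b c *ₛ geo (x c)) S.- IS.neq b a *ₛ ta
        ≈⟨ S.+-cong (IS.sum-neq b (geo ∘ x)) (S.-‿cong (S.trans (S.*-congʳ {ta} (IS.neq-≢ (a≢b ∘ ≡.sym))) (S.*-identityˡ ta))) ⟩
      T x S.- tb S.- ta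
        ≈⟨ solve 3 (λ T a b → T :- b :- a := T :- a :- b) S.refl (T x) ta tb ⟩
      T x S.- ta S.- tb ∎

  twinSeries-rational : (1ₛ S.- D₂) *ₛ twinSeries ≈ₛ S.κ (+ 2) *ₛ (F₂ *ₛ (1ₛ S.- D₂) +ₛ numerator)
  twinSeries-rational = begin
    (1ₛ S.- D₂) *ₛ twinSeries                ≈⟨ S.*-congʳ {twinSeries} denominator-E ⟩
    e *ₛ (1ₛ S.- T x) *ₛ twinSeries          ≈⟨ S.*-assoc e (1ₛ S.- T x) twinSeries ⟩
    e *ₛ ((1ₛ S.- T x) *ₛ twinSeries)        ≈⟨ S.*-congˡ {e} distribute ⟩
    e *ₛ S.sum (λ a → S.sum (λ b → IS.neq a b *ₛ (var (x a) *ₛ var (x b) *ₛ L.weight a b))) ≈⟨ pairs-E ⟩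
    S.κ (+ 2) *ₛ (F₂ *ₛ (1ₛ S.- D₂) +ₛ numerator) ∎
    where
    open SetoidReasoning S.setoid
    distribute : (1ₛ S.- T x) *ₛ twinSeries
      ≈ₛ S.sum (λ a → S.sum (λ b → IS.neq a b *ₛ (var (x a) *ₛ var (x b) *ₛ L.weight a b)))
    distribute = S.trans (S.*-distribˡ-sum (1ₛ S.- T x) (λ a → S.sum (twinTerm a))) (S.sum-cong-≋ λ a →
      S.trans (S.*-distribˡ-sum (1ₛ S.- T x) (twinTerm a)) (S.sum-cong-≋ λ b →
      S.trans (solve 4 (λ q n y w → q :* (n :* (y :* w)) := y :* (n :* (q :* w))) S.refl
                (1ₛ S.- T x) (IS.neq a b) (var (x a) *ₛ var (x b)) (walksAvoiding a b))
      (S.trans (S.*-congˡ {var (x a) *ₛ var (x b)} ([1-T]*walksAvoiding a b))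
               (solve 3 (λ n y w → y :* (n :* w) := n :* (y :* w)) S.refl
                 (IS.neq a b) (var (x a) *ₛ var (x b)) (L.weight a b)))))

  -- The degree 3 + m consists of one z each for v′ and v, and m + 1 for the walk through the rest
  -- of a cycle with m + 2 vertices.
  twinSeries-coeff : ∀ m → twinSeries (3 ℕ.+ m)
    ≈ sum (λ a → sum (λ b → neq a b * (x a * (x b * sum (λ c → avoid a b c * walk (avoid a b) m c)))))
  twinSeries-coeff m = trans (S-sum (λ a → S.sum (twinTerm a)) (3 ℕ.+ m)) (sum-cong-≋ λ a →
    trans (S-sum (twinTerm a) (3 ℕ.+ m)) (sum-cong-≋ λ b →
      trans (S.*-cong (S.sym (neq-const a b)) (S.*-assoc (var (x a)) (var (x b)) (walksAvoiding a b)) (3 ℕ.+ m))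
      (trans (const-*ₛ (neq a b) _ (3 ℕ.+ m)) (*-congˡ
      (trans (var-*ₛ (x a) (var (x b) *ₛ walksAvoiding a b) (3 ℕ.+ m)) (*-congˡ
      (trans (var-*ₛ (x b) (walksAvoiding a b) (2 ℕ.+ m)) (*-congˡ
      (trans (S-sum (λ c → const (avoid a b c) *ₛ walkSeries (avoid a b) c) (1 ℕ.+ m))
        (sum-cong-≋ λ c → const-*ₛ (avoid a b c) (walkSeries (avoid a b) c) (1 ℕ.+ m)))))))))))

-- FPS as a limit of iterated power series rings

private
  -- `_/_` normalises by a gcd that is stuck on a variable numerator, so the homomorphism laws are
  -- checked on unnormalised fractions with denominator 1.
  toℚᵘ-/1 : ∀ i → ℚ.toℚᵘ (i / 1) ℚᵘ.≃ mkℚᵘ i 0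
  toℚᵘ-/1 i = ℚ.toℚᵘ-fromℚᵘ (mkℚᵘ i 0)

/1-+ : ∀ i j → (i ℤ.+ j) / 1 ≡ i / 1 ℚ.+ j / 1
/1-+ i j = ℚ.toℚᵘ-injective (begin
  ℚ.toℚᵘ ((i ℤ.+ j) / 1)               ≈⟨ toℚᵘ-/1 (i ℤ.+ j) ⟩
  mkℚᵘ (i ℤ.+ j) 0                     ≈⟨ *≡* (≡.cong (ℤ._* + 1) (≡.sym (≡.cong₂ ℤ._+_ (ℤ.*-identityʳ i) (ℤ.*-identityʳ j)))) ⟩
  mkℚᵘ i 0 ℚᵘ.+ mkℚᵘ j 0               ≈⟨ ℚᵘ.+-cong (ℚᵘ.≃-sym (toℚᵘ-/1 i)) (ℚᵘ.≃-sym (toℚᵘ-/1 j)) ⟩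
  ℚ.toℚᵘ (i / 1) ℚᵘ.+ ℚ.toℚᵘ (j / 1)   ≈⟨ ℚᵘ.≃-sym (ℚ.toℚᵘ-homo-+ (i / 1) (j / 1)) ⟩
  ℚ.toℚᵘ (i / 1 ℚ.+ j / 1)             ∎)
  where open SetoidReasoning ℚᵘ.≃-setoid

/1-* : ∀ i j → (i ℤ.* j) / 1 ≡ (i / 1) ℚ.* (j / 1)
/1-* i j = ℚ.toℚᵘ-injective (begin
  ℚ.toℚᵘ ((i ℤ.* j) / 1)               ≈⟨ toℚᵘ-/1 (i ℤ.* j) ⟩
  mkℚᵘ i 0 ℚᵘ.* mkℚᵘ j 0               ≈⟨ ℚᵘ.*-cong (ℚᵘ.≃-sym (toℚᵘ-/1 i)) (ℚᵘ.≃-sym (toℚᵘ-/1 j)) ⟩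
  ℚ.toℚᵘ (i / 1) ℚᵘ.* ℚ.toℚᵘ (j / 1)   ≈⟨ ℚᵘ.≃-sym (ℚ.toℚᵘ-homo-* (i / 1) (j / 1)) ⟩
  ℚ.toℚᵘ ((i / 1) ℚ.* (j / 1))             ∎)
  where open SetoidReasoning ℚᵘ.≃-setoid

/1-neg : ∀ i → (ℤ.- i) / 1 ≡ ℚ.- (i / 1)
/1-neg i = ℚ.toℚᵘ-injective (begin
  ℚ.toℚᵘ ((ℤ.- i) / 1)   ≈⟨ toℚᵘ-/1 (ℤ.- i) ⟩
  ℚᵘ.- mkℚᵘ i 0          ≈⟨ ℚᵘ.-‿cong (ℚᵘ.≃-sym (toℚᵘ-/1 i)) ⟩
  ℚᵘ.- ℚ.toℚᵘ (i / 1)    ≈⟨ ℚᵘ.≃-sym (ℚ.toℚᵘ-homo‿- (i / 1)) ⟩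
  ℚ.toℚᵘ (ℚ.- (i / 1))   ∎)
  where open SetoidReasoning ℚᵘ.≃-setoid

-- R k is ℚ[[x₁, …, xₖ]], nested so that x₁ is the outermost variable.
R : ℕ → ℤ-Algebra
R zero = record
  { commutativeRing = ℚ.+-*-commutativeRing
  ; κ = _/ 1
  ; κ-+ = /1-+
  ; κ-* = /1-*
  ; κ-neg = /1-neg
  ; κ-0 = ≡.refl
  ; κ-1 = ≡.refl
  }
R (suc k) = psAlgebra (R k)

module R (k : ℕ) = ℤ-Algebra (R k)
module Ser (k : ℕ) = Elementary (R k)

-- Restriction to the exponent lists of length k, which amounts to setting all variables after the
-- k-th to zero.
φ : ∀ k → D.FPS → R.Carrier k
φ zero    f   = f []
φ (suc k) f n = φ k (λ β → f (n ∷ β))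

φ-cong : ∀ k {f g} → f D.≈ g → R._≈_ k (φ k f) (φ k g)
φ-cong zero    f≈g   = f≈g []
φ-cong (suc k) f≈g n = φ-cong k (λ β → f≈g (n ∷ β))

φ-+ : ∀ k f g → R._≈_ k (φ k (f D.+ g)) (R._+_ k (φ k f) (φ k g))
φ-+ zero    f g   = ≡.refl
φ-+ (suc k) f g n = φ-+ k (λ β → f (n ∷ β)) (λ β → g (n ∷ β))

φ-𝟘 : ∀ k → R._≈_ k (φ k D.𝟘) (R.0# k)
φ-𝟘 zero      = ≡.refl
φ-𝟘 (suc k) n = φ-𝟘 k

φ-𝟙 : ∀ k → R._≈_ k (φ k D.𝟙) (R.1# k)
φ-𝟙 zero            = ≡.refl
φ-𝟙 (suc k) zero    = φ-𝟙 k
φ-𝟙 (suc k) (suc n) = φ-𝟘 k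

-- Only integral scalars, since these are what κ provides. The factor ½ is handled in ℚ, after a
-- coefficient has been taken.
φ-• : ∀ k i f → R._≈_ k (φ k ((i / 1) D.• f)) (R._*_ k (R.κ k i) (φ k f))
φ-• zero    i f   = ≡.refl
φ-• (suc k) i f n = R.trans k (φ-• k i (λ β → f (n ∷ β)))
  (R.sym k (Ser.const-*ₛ k (R.κ k i) (φ (suc k) f) n))

∑-at : ∀ (f : ℕ → D.FPS) m α → D.∑ (applyUpTo f m) α ≡ D.∑ℚ (applyUpTo (λ i → f i α) m)
∑-at f zero    α = ≡.refl
∑-at f (suc m) α = ≡.cong (f 0 α ℚ.+_) (∑-at (f ∘ suc) m α)

*-∷ : ∀ f g a α → (f D.* g) (a ∷ α) ≡ ((λ b β → f (b ∷ β)) D.⊛ (λ b β → g (b ∷ β))) a α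
*-∷ f g a α = ≡.sym (∑-at (λ b → (λ β → f (b ∷ β)) D.* (λ γ → g ((a ∸ b) ∷ γ))) (suc a) α)

-- Splitting off the first exponent turns the product of `FPS` into a convolution in x₁ whose
-- coefficients have one variable fewer. Hence the mutual induction: the product in k + 1 variables
-- rests on `⊛` in k variables, and that on the product in k variables.
φ-*  : ∀ k f g → R._≈_ k (φ k (f D.* g)) (R._*_ k (φ k f) (φ k g))
φ-⊛ : ∀ k A B n → R._≈_ k (φ k ((A D.⊛ B) n)) (Ser._*ₛ_ k (φ k ∘ A) (φ k ∘ B) n)

φ-* zero    f g   = ≡.refl
φ-* (suc k) f g n = R.trans k (φ-cong k (*-∷ f g n)) (φ-⊛ k (λ b β → f (b ∷ β)) (λ b β → g (b ∷ β)) n)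

φ-⊛ k A B zero = begin
  φ k (A 0 D.* B 0 D.+ D.𝟘)                  ≈⟨ φ-+ k _ D.𝟘 ⟩
  φ k (A 0 D.* B 0) + φ k D.𝟘                ≈⟨ +-cong (φ-* k (A 0) (B 0)) (φ-𝟘 k) ⟩
  φ k (A 0) * φ k (B 0) + 0#                 ≈⟨ +-identityʳ _ ⟩
  φ k (A 0) * φ k (B 0)                      ∎
  where
  open ℤ-Algebra (R k)
  open SetoidReasoning setoid
φ-⊛ k A B (suc n) = begin
  φ k (A 0 D.* B (suc n) D.+ ((A ∘ suc) D.⊛ B) n)      ≈⟨ φ-+ k (A 0 D.* B (suc n)) (((A ∘ suc) D.⊛ B) n) ⟩
  φ k (A 0 D.* B (suc n)) + φ k (((A ∘ suc) D.⊛ B) n)  ≈⟨ +-cong (φ-* k (A 0) (B (suc n))) (φ-⊛ k (A ∘ suc) B n) ⟩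
  φ k (A 0) * φ k (B (suc n)) + Ser._*ₛ_ k (φ k ∘ A ∘ suc) (φ k ∘ B) n ∎
  where
  open ℤ-Algebra (R k)
  open SetoidReasoning setoid

ev : ∀ α → R.Carrier (length α) → ℚ
ev []      r = r
ev (a ∷ α) r = ev α (r a)

ev-φ : ∀ α f → ev α (φ (length α) f) ≡ f α
ev-φ []      f = ≡.refl
ev-φ (a ∷ α) f = ev-φ α (λ β → f (a ∷ β))

ev-cong : ∀ α {r s} → R._≈_ (length α) r s → ev α r ≡ ev α s
ev-cong []      p = p
ev-cong (a ∷ α) p = ev-cong α (p a)

ev-+ : ∀ α r s → ev α (R._+_ (length α) r s) ≡ ev α r ℚ.+ ev α s
ev-+ []      r s = ≡.refl
ev-+ (a ∷ α) r s = ev-+ α (r a) (s a)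

ev-0 : ∀ α → ev α (R.0# (length α)) ≡ 0ℚ
ev-0 []      = ≡.refl
ev-0 (a ∷ α) = ev-0 α

ev-κ : ∀ α i r → ev α (R._*_ (length α) (R.κ (length α) i) r) ≡ (i / 1) ℚ.* ev α r
ev-κ []      i r = ≡.refl
ev-κ (a ∷ α) i r = ≡.trans (ev-cong α (Ser.const-*ₛ (length α) (R.κ (length α) i) r a)) (ev-κ α i (r a))

-- The coefficient of α is read off in `length α` variables. Through this lemma `FPS` inherits its
-- ring laws from the rings `R k`.
φ-separates : ∀ {f g} → (∀ k → R._≈_ k (φ k f) (φ k g)) → f D.≈ g
φ-separates {f} {g} p α =
  ≡.trans (≡.sym (ev-φ α f)) (≡.trans (ev-cong α (p (length α))) (ev-φ α g))

letter : ∀ k → Fin k → R.Carrier k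
letter (suc k) zero    = Ser.var k (R.1# k)
letter (suc k) (suc c) = Ser.const k (letter k c)

module ConstantElementary (A : ℤ-Algebra) where
  open ℤ-Algebra A
  open Elementary A
  module E₁ = Elementary S

  -- In `R (suc k)` the letters other than x₁ are constant series; the recursion `E-suc` commutes
  -- with `const` because `const` is a ring homomorphism.
  E-const : ∀ {k} (x : Fin k → Carrier) i → E₁.E (const ∘ x) i ≈ₛ const (E x i)
  E-const {zero}  x zero    = λ _ → refl
  E-const {zero}  x (suc i) = S.sym const-0
  E-const {suc k} x zero    = S.trans (E₁.E-0 (const ∘ x)) (S.sym (const-cong (E-0 x)))
  E-const {suc k} x (suc i) = begin
    E₁.E (const ∘ x) (suc i)
      ≈⟨ E₁.E-suc (const ∘ x) i ⟩
    const (x zero) *ₛ E₁.E (const ∘ x ∘ suc) i +ₛ E₁.E (const ∘ x ∘ suc) (suc i)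
      ≈⟨ S.+-cong (S.*-congˡ {const (x zero)} (E-const (x ∘ suc) i)) (E-const (x ∘ suc) (suc i)) ⟩
    const (x zero) *ₛ const (E (x ∘ suc) i) +ₛ const (E (x ∘ suc) (suc i))
      ≈⟨ S.+-congʳ (S.sym (const-* (x zero) (E (x ∘ suc) i))) ⟩
    const (x zero * E (x ∘ suc) i) +ₛ const (E (x ∘ suc) (suc i))
      ≈⟨ S.sym (const-+ _ _) ⟩
    const (x zero * E (x ∘ suc) i + E (x ∘ suc) (suc i))
      ≈⟨ const-cong (sym (E-suc x i)) ⟩
    const (E x (suc i)) ∎
    where open SetoidReasoning S.setoid

e-2+∷ : ∀ i b β → D.e i (suc (suc b) ∷ β) ≡ 0ℚ
e-2+∷ i b β = ≡.cong (if_then 1ℚ else 0ℚ) (Bool.∧-zeroʳ _)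

-- A squarefree monomial has exponent 0 or 1 at x₁, and these cases are the two summands of `E-suc`;
-- exponents from 2 on give zero.
φ-e : ∀ k i → R._≈_ k (φ k (D.e i)) (Ser.E k (letter k) i)
φ-e zero    zero    = ≡.refl
φ-e zero    (suc i) = ≡.refl
φ-e (suc k) zero b = R.trans k (const-1 b) (R.sym k (Ser.E-0 (suc k) (letter (suc k)) b))
  where
  const-1 : ∀ b → R._≈_ k (φ k (λ β → D.e 0 (b ∷ β))) (R.1# (suc k) b)
  const-1 zero          = R.trans k (φ-e k 0) (Ser.E-0 k (letter k))
  const-1 (suc zero)    = φ-𝟘 k
  const-1 (suc (suc b)) = R.trans k (φ-cong k (e-2+∷ 0 b)) (φ-𝟘 k)
φ-e (suc k) (suc i) b = trans (split b) (sym (begin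
  Ser.E (suc k) (letter (suc k)) (suc i) b
    ≈⟨ Ser.E-suc (suc k) (letter (suc k)) i b ⟩
  (var 1# *ₛ Ser.E (suc k) (const ∘ letter k) i) b + Ser.E (suc k) (const ∘ letter k) (suc i) b
    ≈⟨ +-cong (S.*-congˡ {var 1#} (E-const (letter k) i) b) (E-const (letter k) (suc i) b) ⟩
  (var 1# *ₛ const (E (letter k) i)) b + const (E (letter k) (suc i)) b
    ≈⟨ +-congʳ (var-*ₛ 1# (const (E (letter k) i)) b) ⟩
  shift (scale 1# (const (E (letter k) i))) b + const (E (letter k) (suc i)) b ∎))
  where
  open ℤ-Algebra (R k)
  open Elementary (R k)
  open ConstantElementary (R k)
  open SetoidReasoning setoid
  split : ∀ b → φ k (λ β → D.e (suc i) (b ∷ β))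
               ≈ shift (scale 1# (const (E (letter k) i))) b + const (E (letter k) (suc i)) b
  split zero          = trans (φ-e k (suc i)) (sym (+-identityˡ _))
  split (suc zero)    = trans (φ-e k i) (sym (trans (+-identityʳ _) (*-identityˡ _)))
  split (suc (suc b)) = trans (trans (φ-cong k (e-2+∷ (suc i) b)) (φ-𝟘 k))
    (sym (trans (+-identityʳ _) (zeroʳ 1#)))

-- Chromatic symmetric functions as sums over colorings

module Weights (A : ℤ-Algebra) where
  open ℤ-Algebra A
  open Indicator A using (neq)

  -- Ties a 0/1 element to a proposition, so that a product of `neq` factors can replace a decision
  -- procedure without inspecting how it decides.
  Indicates : Carrier → Set → Set
  Indicates r P = (P × r ≈ 1#) ⊎ (¬ P × r ≈ 0#)

  indicates-× : ∀ {r s P Q} → Indicates r P → Indicates s Q → Indicates (r * s) (P × Q)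
  indicates-× (inj₁ (p , r)) (inj₁ (q , s)) = inj₁ ((p , q) , trans (*-cong r s) (*-identityˡ 1#))
  indicates-× (inj₁ (p , r)) (inj₂ (q , s)) = inj₂ (q ∘ proj₂ , trans (*-congˡ s) (zeroʳ _))
  indicates-× (inj₂ (p , r)) _              = inj₂ (p ∘ proj₁ , trans (*-congʳ r) (zeroˡ _))

  indicates-unique : ∀ {r s P Q} → (P → Q) → (Q → P) → Indicates r P → Indicates s Q → r ≈ s
  indicates-unique f g (inj₁ (_ , r)) (inj₁ (_ , s)) = trans r (sym s)
  indicates-unique f g (inj₁ (p , _)) (inj₂ (q , _)) = ⊥-elim (q (f p))
  indicates-unique f g (inj₂ (p , _)) (inj₁ (q , _)) = ⊥-elim (p (g q))
  indicates-unique f g (inj₂ (_ , r)) (inj₂ (_ , s)) = trans r (sym s)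

  ind : ∀ {P : Set} → Dec P → Carrier
  ind P? = if does P? then 1# else 0#

  indicates-ind : ∀ {P} (P? : Dec P) → Indicates (ind P?) P
  indicates-ind (yes p) = inj₁ (p , refl)
  indicates-ind (no ¬p) = inj₂ (¬p , refl)

  indicates-neq : ∀ {k} (a b : Fin k) → Indicates (neq a b) (a ≢ b)
  indicates-neq a b with a Fin.≟ b
  ... | yes a≡b = inj₂ ((λ a≢b → a≢b a≡b) , refl)
  ... | no  a≢b = inj₁ (a≢b , refl)

module ColorSums (A : ℤ-Algebra) (k : ℕ) where
  open ℤ-Algebra A
  open Sum semiring
  open Indicator A using (neq)

  csum : ∀ n → (Vec (Fin k) n → Carrier) → Carrier
  csum zero    F = F []
  csum (suc n) F = sum (λ c → csum n (λ κ → F (c ∷ κ)))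

  csum-cong : ∀ n {F G} → (∀ κ → F κ ≈ G κ) → csum n F ≈ csum n G
  csum-cong zero    p = p []
  csum-cong (suc n) p = sum-cong-≋ λ c → csum-cong n (λ κ → p (c ∷ κ))

  *-csum : ∀ n r F → r * csum n F ≈ csum n (λ κ → r * F κ)
  *-csum zero    r F = refl
  *-csum (suc n) r F = trans (*-distribˡ-sum r (λ c → csum n (λ κ → F (c ∷ κ))))
    (sum-cong-≋ λ c → *-csum n r (λ κ → F (c ∷ κ)))

  rotate : ∀ {n} → Vec (Fin k) (suc n) → Vec (Fin k) (suc n)
  rotate (c ∷ κ) = κ ∷ʳ c

  -- The sum over the first letter is moved inwards past the other letters, one interchange of sums
  -- for each.
  csum-rotate : ∀ n F → csum (suc n) F ≈ csum (suc n) (F ∘ rotate)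
  csum-rotate zero    F = refl
  csum-rotate (suc n) F = trans
    (sum-cong-≋ λ d → csum-rotate n (λ κ → F (d ∷ κ)))
    (∑-comm (λ d c → csum n (λ κ → F (d ∷ (κ ∷ʳ c)))))

  module _ (x : Fin k → Carrier) where
    wt : ∀ {n} → Vec (Fin k) n → Carrier
    wt []      = 1#
    wt (c ∷ κ) = x c * wt κ

    wt-∷ʳ : ∀ {n} c (κ : Vec (Fin k) n) → wt (κ ∷ʳ c) ≈ x c * wt κ
    wt-∷ʳ c []      = refl
    wt-∷ʳ c (d ∷ κ) = trans (*-congˡ (wt-∷ʳ c κ))
      (trans (sym (*-assoc _ _ _)) (trans (*-congʳ (*-comm _ _)) (*-assoc _ _ _)))

    wt-rotate : ∀ {n} (κ : Vec (Fin k) (suc n)) → wt (rotate κ) ≈ wt κ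
    wt-rotate (c ∷ κ) = wt-∷ʳ c κ

    path : (Fin k → Carrier) → ∀ {m} → Fin k → Vec (Fin k) m → Carrier
    path h c []      = h c
    path h c (d ∷ κ) = neq c d * path h d κ

    csum-path : ∀ h m c → csum m (λ κ → path h c κ * wt (c ∷ κ)) ≈ TwinnedCycles.walk A x h m c
    csum-path h zero    c = trans (*-congˡ (*-identityʳ _)) (*-comm _ _)
    csum-path h (suc m) c = begin
      sum (λ d → csum m (λ κ → neq c d * path h d κ * (x c * wt (d ∷ κ))))
        ≈⟨ sum-cong-≋ (λ d → trans
             (csum-cong m λ κ → solve 4 (λ n p x w → n :* p :* (x :* w) := x :* n :* (p :* w)) refl
               (neq c d) (path h d κ) (x c) (wt (d ∷ κ)))
             (trans (sym (*-csum m (x c * neq c d) (λ κ → path h d κ * wt (d ∷ κ))))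
             (trans (*-congˡ (csum-path h m d)) (*-assoc _ _ _)))) ⟩
      sum (λ d → x c * (neq c d * TwinnedCycles.walk A x h m d))
        ≈⟨ sym (*-distribˡ-sum (x c) (λ d → neq c d * TwinnedCycles.walk A x h m d)) ⟩
      x c * sum (λ d → neq c d * TwinnedCycles.walk A x h m d) ∎
      where
      open SetoidReasoning setoid
      open Solver A using (solve; _:=_; _:*_)

private
  module ℚSum = Sum (R.semiring 0)
  module ℚColor = ColorSums (R 0)
  module ℚWeights = Weights (R 0)

length-filter : ∀ {a} {B : Set a} {P : B → Set} (P? : Decidable P) (xs : List B) →
  + length (filter P? xs) / 1 ≡ D.∑ℚ (map (λ y → ℚWeights.ind (P? y)) xs)
length-filter P? [] = ≡.refl
length-filter P? (y ∷ xs) with does (P? y)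
... | true  = ≡.trans (/1-+ 1ℤ (+ length (filter P? xs))) (≡.cong (1ℚ ℚ.+_) (length-filter P? xs))
... | false = ≡.trans (length-filter P? xs) (≡.sym (ℚ.+-identityˡ _))

∑ℚ-++ : ∀ xs ys → D.∑ℚ (xs ++ ys) ≡ D.∑ℚ xs ℚ.+ D.∑ℚ ys
∑ℚ-++ []       ys = ≡.sym (ℚ.+-identityˡ _)
∑ℚ-++ (p ∷ xs) ys = ≡.trans (≡.cong (p ℚ.+_) (∑ℚ-++ xs ys)) (≡.sym (ℚ.+-assoc p _ _))

-- Stated for `tabulate q` because the tail of `allFin` is a `tabulate suc` and no longer an
-- `allFin`.
∑ℚ-cartesianProductWith : ∀ {k m} {B C : Set} (f : Fin k → B → C) (g : C → ℚ) (q : Fin m → Fin k) (ys : List B) →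
  D.∑ℚ (map g (cartesianProductWith f (tabulate q) ys)) ≡ ℚSum.sum (λ c → D.∑ℚ (map (g ∘ f (q c)) ys))
∑ℚ-cartesianProductWith {m = zero}  f g q ys = ≡.refl
∑ℚ-cartesianProductWith {m = suc m} f g q ys = begin
  D.∑ℚ (map g (map (f (q zero)) ys ++ cartesianProductWith f (tabulate (q ∘ suc)) ys))
    ≡⟨ ≡.cong D.∑ℚ (List.map-++ g (map (f (q zero)) ys) _) ⟩
  D.∑ℚ (map g (map (f (q zero)) ys) ++ map g (cartesianProductWith f (tabulate (q ∘ suc)) ys))
    ≡⟨ ∑ℚ-++ (map g (map (f (q zero)) ys)) _ ⟩
  D.∑ℚ (map g (map (f (q zero)) ys)) ℚ.+ D.∑ℚ (map g (cartesianProductWith f (tabulate (q ∘ suc)) ys))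
    ≡⟨ ≡.cong₂ ℚ._+_ (≡.cong D.∑ℚ (≡.sym (List.map-∘ ys))) (∑ℚ-cartesianProductWith f g (q ∘ suc) ys) ⟩
  D.∑ℚ (map (g ∘ f (q zero)) ys) ℚ.+ ℚSum.sum (λ c → D.∑ℚ (map (g ∘ f (q (suc c))) ys)) ∎
  where open ≡.≡-Reasoning

∑ℚ-colorings : ∀ k n (g : Vec (Fin k) n → ℚ) → D.∑ℚ (map g (D.colorings k n)) ≡ ℚColor.csum k n g
∑ℚ-colorings k zero    g = ℚ.+-identityʳ _
∑ℚ-colorings k (suc n) g = ≡.trans (∑ℚ-cartesianProductWith _∷_ g id (D.colorings k n))
  (ℚSum.sum-cong-≗ λ c → ∑ℚ-colorings k n (λ κ → g (c ∷ κ)))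

ev-sum : ∀ α {m} (f : Fin m → R.Carrier (length α)) →
  ev α (Sum.sum (R.semiring (length α)) f) ≡ ℚSum.sum (ev α ∘ f)
ev-sum α {zero}  f = ev-0 α
ev-sum α {suc m} f = ≡.trans (ev-+ α (f zero) _) (≡.cong (ev α (f zero) ℚ.+_) (ev-sum α (f ∘ suc)))

ev-csum : ∀ α k n (F : Vec (Fin k) n → R.Carrier (length α)) →
  ev α (ColorSums.csum (R (length α)) k n F) ≡ ℚColor.csum k n (ev α ∘ F)
ev-csum α k zero    F = ≡.refl
ev-csum α k (suc n) F = ≡.trans (ev-sum α (λ c → ColorSums.csum (R (length α)) k n (λ κ → F (c ∷ κ))))
  (ℚSum.sum-cong-≗ λ c → ev-csum α k n (λ κ → F (c ∷ κ)))

monomial : ∀ k → (Fin k → ℕ) → R.Carrier k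
monomial zero    g = R.1# 0
monomial (suc k) g = Ser.mono k (g zero) (monomial k (g ∘ suc))

monomial-cong : ∀ k {g h} → (∀ c → g c ≡ h c) → R._≈_ k (monomial k g) (monomial k h)
monomial-cong zero    p = ≡.refl
monomial-cong (suc k) {g} {h} p = R.trans (suc k)
  (R.reflexive (suc k) (≡.cong (λ i → Ser.mono k i (monomial k (g ∘ suc))) (p zero)))
  (Ser.mono-cong k (h zero) (monomial-cong k (p ∘ suc)))

monomial-0 : ∀ k → R._≈_ k (monomial k (λ _ → 0)) (R.1# k)
monomial-0 zero    = ≡.refl
monomial-0 (suc k) = R.trans (suc k) (Ser.mono-0 k _) (Ser.const-cong k (monomial-0 k))

bump : ∀ {k} → Fin k → (Fin k → ℕ) → Fin k → ℕ
bump c g d = if does (c Fin.≟ d) then suc (g d) else g d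

letter-monomial : ∀ k c g → R._≈_ k (R._*_ k (letter k c) (monomial k g)) (monomial k (bump c g))
letter-monomial (suc k) zero g = R.trans (suc k) (Ser.var-mono k (g zero) (R.1# k) _)
  (Ser.mono-cong k (suc (g zero)) (R.*-identityˡ k _))
letter-monomial (suc k) (suc c) g n = trans (const-*ₛ (letter k c) (mono (g zero) (monomial k (g ∘ suc))) n) scaled
  where
  open ℤ-Algebra (R k)
  open Elementary (R k)
  scaled : letter k c * mono (g zero) (monomial k (g ∘ suc)) n ≈ mono (g zero) (monomial k (bump c (g ∘ suc))) n
  scaled with does (n ≟ g zero)
  ... | true  = letter-monomial k c (g ∘ suc)
  ... | false = zeroʳ _

wt-letters : ∀ k {n} (κ : Vec (Fin k) n) →
  R._≈_ k (ColorSums.wt (R k) k (letter k) κ) (monomial k (λ c → count (Fin._≟ c) κ))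
wt-letters k []      = R.sym k (monomial-0 k)
wt-letters k (c ∷ κ) = R.trans k (R.*-congˡ k (wt-letters k κ))
  (R.trans k (letter-monomial k c (λ d → count (Fin._≟ d) κ)) (monomial-cong k step))
  where
  step : ∀ d → bump c (λ d → count (Fin._≟ d) κ) d ≡ count (Fin._≟ d) (c ∷ κ)
  step d with does (c Fin.≟ d)
  ... | true  = ≡.refl
  ... | false = ≡.refl

ev-monomial : ∀ α g → ℚWeights.Indicates (ev α (monomial (length α) g)) (∀ c → g c ≡ List.lookup α c)
ev-monomial []      g = inj₁ ((λ ()) , ≡.refl)
ev-monomial (a ∷ α) g with a ℕ.≟ g zero
... | no a≢g = inj₂ ((λ p → a≢g (≡.sym (p zero))) ,
      ≡.trans (≡.cong (λ b → ev α (if b then monomial (length α) (g ∘ suc) else R.0# (length α))) (dec-false (a ℕ.≟ g zero) a≢g)) (ev-0 α))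
... | yes a≡g with ev-monomial α (g ∘ suc)
...   | inj₁ (p , q) = inj₁ ((λ { zero → ≡.sym a≡g ; (suc c) → p c }) ,
        ≡.trans (≡.cong (λ b → ev α (if b then monomial (length α) (g ∘ suc) else R.0# (length α))) (dec-true (a ℕ.≟ g zero) a≡g)) q)
...   | inj₂ (p , q) = inj₂ ((λ r → p (r ∘ suc)) ,
        ≡.trans (≡.cong (λ b → ev α (if b then monomial (length α) (g ∘ suc) else R.0# (length α))) (dec-true (a ℕ.≟ g zero) a≡g)) q)

chromatic : ∀ k {n} → D.Graph n → R.Carrier k
chromatic k {n} G = csum n (λ κ → ind (D.proper? G κ) * wt (letter k) κ)
  where
  open ℤ-Algebra (R k)
  open ColorSums (R k) k
  open Weights (R k)

-- With `length α` colors, the content condition says that α is the exponent of the weight of κ, so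
-- counting the colorings with this content is taking the coefficient of α in a weighted sum.
X-chromatic : ∀ {n} (G : D.Graph n) α → D.X G α ≡ ev α (chromatic (length α) G)
X-chromatic {n} G α = begin
  D.X G α
    ≡⟨ length-filter (λ κ → D.proper? G κ ×-dec D.hasContent? α κ) (D.colorings k n) ⟩
  D.∑ℚ (map (λ κ → ℚWeights.ind (D.proper? G κ ×-dec D.hasContent? α κ)) (D.colorings k n))
    ≡⟨ ∑ℚ-colorings k n _ ⟩
  ℚColor.csum k n (λ κ → ℚWeights.ind (D.proper? G κ ×-dec D.hasContent? α κ))
    ≡⟨ ℚColor.csum-cong k n term ⟩
  ℚColor.csum k n (λ κ → ev α (ind (D.proper? G κ) * wt (letter k) κ))
    ≡⟨ ≡.sym (ev-csum α k n (λ κ → ind (D.proper? G κ) * wt (letter k) κ)) ⟩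
  ev α (chromatic k G) ∎
  where
  open ≡.≡-Reasoning
  k = length α
  open ℤ-Algebra (R k)
  open ColorSums (R k) k
  open Weights (R k)
  term : ∀ κ → ℚWeights.ind (D.proper? G κ ×-dec D.hasContent? α κ) ≡ ev α (ind (D.proper? G κ) * wt (letter k) κ)
  term κ with does (D.proper? G κ)
  ... | false = ≡.sym (≡.trans (ev-cong α (zeroˡ _)) (ev-0 α))
  ... | true  = ≡.trans
    (ℚWeights.indicates-unique id id (ℚWeights.indicates-ind (D.hasContent? α κ)) (ev-monomial α (λ c → count (Fin._≟ c) κ)))
    (≡.sym (ev-cong α (trans (*-identityˡ _) (wt-letters k κ))))

-- Rotating the twinned vertex to zero

lookup-∷ʳ-fromℕ : ∀ {B : Set} {n} (c : B) (κ : Vec B n) → lookup (κ ∷ʳ c) (fromℕ n) ≡ c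
lookup-∷ʳ-fromℕ c []      = ≡.refl
lookup-∷ʳ-fromℕ c (_ ∷ κ) = lookup-∷ʳ-fromℕ c κ

lookup-∷ʳ-inject₁ : ∀ {B : Set} {n} (c : B) (κ : Vec B n) i → lookup (κ ∷ʳ c) (inject₁ i) ≡ lookup κ i
lookup-∷ʳ-inject₁ c (_ ∷ κ) zero    = ≡.refl
lookup-∷ʳ-inject₁ c (_ ∷ κ) (suc i) = lookup-∷ʳ-inject₁ c κ i

-- The cyclic predecessor, a rotation of the cycle. Since `rotate` moves the first letter to the
-- end, the color of u reappears at `predᶜ u`.
predᶜ : ∀ {n} → Fin (suc n) → Fin (suc n)
predᶜ {n} zero = fromℕ n
predᶜ (suc i)  = inject₁ i

predᶜ-injective : ∀ {n} {u w : Fin (suc n)} → predᶜ u ≡ predᶜ w → u ≡ w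
predᶜ-injective {u = zero}  {zero}  p = ≡.refl
predᶜ-injective {u = zero}  {suc j} p = ⊥-elim (Fin.fromℕ≢inject₁ p)
predᶜ-injective {u = suc i} {zero}  p = ⊥-elim (Fin.fromℕ≢inject₁ (≡.sym p))
predᶜ-injective {u = suc i} {suc j} p = ≡.cong suc (Fin.inject₁-injective p)

predᶜ-surjective : ∀ {n} (u : Fin (suc n)) → ∃ λ w → predᶜ w ≡ u
predᶜ-surjective u with view u
... | ‵fromℕ     = zero , ≡.refl
... | ‵inject₁ i = suc i , ≡.refl

toℕ-predᶜ-zero : ∀ n → toℕ (predᶜ {n} zero) ≡ n
toℕ-predᶜ-zero = Fin.toℕ-fromℕ

toℕ-predᶜ-suc : ∀ {n} (i : Fin n) → toℕ (predᶜ (suc i)) ≡ toℕ i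
toℕ-predᶜ-suc = Fin.toℕ-inject₁

Next-predᶜ : ∀ {n} (u w : Fin (suc n)) → D.Next u w → D.Next (predᶜ u) (predᶜ w)
Next-predᶜ {n} zero zero (inj₂ (1≡1+n , _)) =
  inj₂ (≡.cong suc (toℕ-predᶜ-zero n) , ≡.trans (toℕ-predᶜ-zero n) (≡.sym (ℕ.suc-injective 1≡1+n)))
Next-predᶜ {n} zero (suc j) (inj₁ p) =
  inj₂ (≡.cong suc (toℕ-predᶜ-zero n) , ≡.trans (toℕ-predᶜ-suc j) (ℕ.suc-injective p))
Next-predᶜ {n} (suc i) zero (inj₂ (p , _)) =
  inj₁ (≡.trans (toℕ-predᶜ-zero n) (≡.trans (≡.sym (ℕ.suc-injective p)) (≡.cong suc (≡.sym (toℕ-predᶜ-suc i)))))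
Next-predᶜ (suc i) (suc j) (inj₁ p) =
  inj₁ (≡.trans (toℕ-predᶜ-suc j) (≡.trans (ℕ.suc-injective p) (≡.cong suc (≡.sym (toℕ-predᶜ-suc i)))))

Next-predᶜ⁻¹ : ∀ {n} (u w : Fin (suc n)) → D.Next (predᶜ u) (predᶜ w) → D.Next u w
Next-predᶜ⁻¹ zero zero (inj₁ p) = ⊥-elim (ℕ.1+n≢n (≡.sym p))
Next-predᶜ⁻¹ {n} zero zero (inj₂ (_ , p)) =
  inj₂ (≡.cong suc (≡.trans (≡.sym p) (toℕ-predᶜ-zero n)) , ≡.refl)
Next-predᶜ⁻¹ {n} zero (suc j) (inj₁ p) =
  ⊥-elim (ℕ.<⇒≢ (ℕ.m≤n⇒m≤1+n (Fin.toℕ<n j)) (≡.trans (≡.sym (toℕ-predᶜ-suc j)) (≡.trans p (≡.cong suc (toℕ-predᶜ-zero n)))))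
Next-predᶜ⁻¹ zero (suc j) (inj₂ (_ , p)) = inj₁ (≡.cong suc (≡.trans (≡.sym (toℕ-predᶜ-suc j)) p))
Next-predᶜ⁻¹ {n} (suc i) zero (inj₁ p) =
  inj₂ (≡.cong suc (≡.trans (≡.cong suc (≡.sym (toℕ-predᶜ-suc i))) (≡.trans (≡.sym p) (toℕ-predᶜ-zero n))) , ≡.refl)
Next-predᶜ⁻¹ (suc i) zero (inj₂ (p , _)) =
  ⊥-elim (ℕ.<⇒≢ (Fin.toℕ<n i) (≡.trans (≡.sym (toℕ-predᶜ-suc i)) (ℕ.suc-injective p)))
Next-predᶜ⁻¹ (suc i) (suc j) (inj₁ p) =
  inj₁ (≡.cong suc (≡.trans (≡.sym (toℕ-predᶜ-suc j)) (≡.trans p (≡.cong suc (toℕ-predᶜ-suc i)))))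
Next-predᶜ⁻¹ (suc i) (suc j) (inj₂ (p , _)) =
  ⊥-elim (ℕ.<⇒≢ (Fin.toℕ<n i) (≡.trans (≡.sym (toℕ-predᶜ-suc i)) (ℕ.suc-injective p)))

module Rotation {n} (3≤n : 3 ≤ suc n) (v : Fin (suc n)) {k : ℕ} where
  open ColorSums (R k) k using (rotate)

  private
    G G′ : D.Graph (suc (suc n))
    G  = D.twin (D.cycle (suc n) 3≤n) v
    G′ = D.twin (D.cycle (suc n) 3≤n) (predᶜ v)
    module G = D.Graph G
    module G′ = D.Graph G′

  lift : Fin (suc (suc n)) → Fin (suc (suc n))
  lift zero    = zero
  lift (suc u) = suc (predᶜ u)

  lift-surjective : ∀ u → ∃ λ w → lift w ≡ u
  lift-surjective zero    = zero , ≡.refl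
  lift-surjective (suc u) with predᶜ-surjective u
  ... | w , ≡.refl = suc w , ≡.refl

  lookup-rotate : ∀ a κ u → lookup (a ∷ rotate κ) (lift u) ≡ lookup (a ∷ κ) u
  lookup-rotate a κ       zero          = ≡.refl
  lookup-rotate a (c ∷ κ) (suc zero)    = lookup-∷ʳ-fromℕ c κ
  lookup-rotate a (c ∷ κ) (suc (suc i)) = lookup-∷ʳ-inject₁ c κ i

  private
    cyc⇒ : ∀ u w → D.Next {suc n} u w ⊎ D.Next w u → D.Next {suc n} (predᶜ u) (predᶜ w) ⊎ D.Next (predᶜ w) (predᶜ u)
    cyc⇒ u w = Sum⊎.map (Next-predᶜ u w) (Next-predᶜ w u)

    cyc⇐ : ∀ u w → D.Next {suc n} (predᶜ u) (predᶜ w) ⊎ D.Next (predᶜ w) (predᶜ u) → D.Next u w ⊎ D.Next w u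
    cyc⇐ u w = Sum⊎.map (Next-predᶜ⁻¹ u w) (Next-predᶜ⁻¹ w u)

  ~-lift : ∀ u w → u G.~ w → lift u G′.~ lift w
  ~-lift zero    (suc w) = Sum⊎.map (≡.cong predᶜ) (cyc⇒ w v)
  ~-lift (suc u) zero    = Sum⊎.map (≡.cong predᶜ) (cyc⇒ u v)
  ~-lift (suc u) (suc w) = cyc⇒ u w

  ~-lift⁻¹ : ∀ u w → lift u G′.~ lift w → u G.~ w
  ~-lift⁻¹ zero    (suc w) = Sum⊎.map predᶜ-injective (cyc⇐ w v)
  ~-lift⁻¹ (suc u) zero    = Sum⊎.map predᶜ-injective (cyc⇐ u v)
  ~-lift⁻¹ (suc u) (suc w) = cyc⇐ u w

  proper-rotate : ∀ a κ → D.Proper G (a ∷ κ) → D.Proper G′ (a ∷ rotate κ)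
  proper-rotate a κ p u w u~w with lift-surjective u | lift-surjective w
  ... | u′ , ≡.refl | w′ , ≡.refl = λ q → p u′ w′ (~-lift⁻¹ u′ w′ u~w)
    (≡.trans (≡.sym (lookup-rotate a κ u′)) (≡.trans q (lookup-rotate a κ w′)))

  proper-rotate⁻¹ : ∀ a κ → D.Proper G′ (a ∷ rotate κ) → D.Proper G (a ∷ κ)
  proper-rotate⁻¹ a κ p u w u~w q = p (lift u) (lift w) (~-lift u w u~w)
    (≡.trans (lookup-rotate a κ u) (≡.trans q (≡.sym (lookup-rotate a κ w))))

  chromatic-rotate : R._≈_ k (chromatic k G) (chromatic k G′)
  chromatic-rotate = sum-cong-≋ λ a → trans
    (csum-cong (suc n) λ κ → *-cong
      (indicates-unique (proper-rotate a κ) (proper-rotate⁻¹ a κ)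
        (indicates-ind (D.proper? G (a ∷ κ))) (indicates-ind (D.proper? G′ (a ∷ rotate κ))))
      (*-congˡ {letter k a} (sym (wt-rotate (letter k) κ))))
    (sym (csum-rotate n (λ κ → ind (D.proper? G′ (a ∷ κ)) * wt (letter k) (a ∷ κ))))
    where
    open ℤ-Algebra (R k)
    open Sum semiring
    open ColorSums (R k) k hiding (rotate)
    open Weights (R k)

-- Vertex transitivity of the cycle. `predᶜ (suc i)` is `inject₁ i`, so one rotation lands on the
-- induction hypothesis.
chromatic-twin-cycle : ∀ k n (3≤n : 3 ≤ suc n) v →
  R._≈_ k (chromatic k (D.twin (D.cycle (suc n) 3≤n) v)) (chromatic k (D.twin (D.cycle (suc n) 3≤n) zero))
chromatic-twin-cycle k n 3≤n = <-weakInduction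
  (λ v → R._≈_ k (chromatic k (D.twin (D.cycle (suc n) 3≤n) v)) (chromatic k (D.twin (D.cycle (suc n) 3≤n) zero)))
  (R.refl k)
  (λ i p → R.trans k (Rotation.chromatic-rotate 3≤n (suc i) {k}) p)

-- Proper colorings of the twin as walks

module _ {k : ℕ} (a b : Fin k) where
  Path : ∀ {m} → Fin k → Vec (Fin k) m → Set
  Path c []      = a ≢ c × b ≢ c
  Path c (d ∷ κ) = c ≢ d × Path d κ

  path-intro : ∀ {m} c (κ : Vec (Fin k) m) →
    (∀ i j → toℕ j ≡ suc (toℕ i) → lookup (c ∷ κ) i ≢ lookup (c ∷ κ) j) →
    a ≢ lookup (c ∷ κ) (fromℕ m) → b ≢ lookup (c ∷ κ) (fromℕ m) → Path c κ
  path-intro c []      step a≢ b≢ = a≢ , b≢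
  path-intro c (d ∷ κ) step a≢ b≢ = step zero (suc zero) ≡.refl ,
    path-intro d κ (λ i j p → step (suc i) (suc j) (≡.cong suc p)) a≢ b≢

  path-step : ∀ {m} c (κ : Vec (Fin k) m) → Path c κ →
    ∀ i j → toℕ j ≡ suc (toℕ i) → lookup (c ∷ κ) i ≢ lookup (c ∷ κ) j
  path-step c (d ∷ κ) (c≢d , _) zero    (suc zero)    _ = c≢d
  path-step c (d ∷ κ) (_ , p)   (suc i) (suc j)       q = path-step d κ p i j (ℕ.suc-injective q)
  path-step c []      _         zero    (suc ())      _

  path-last : ∀ {m} c (κ : Vec (Fin k) m) → Path c κ → ∀ i → toℕ i ≡ m →
    a ≢ lookup (c ∷ κ) i × b ≢ lookup (c ∷ κ) i
  path-last c []      p       zero    _ = p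
  path-last c (d ∷ κ) (_ , p) (suc i) q = path-last d κ p i (ℕ.suc-injective q)

  module _ {m : ℕ} (3≤n : 3 ≤ suc (suc m)) (c : Fin k) (κ : Vec (Fin k) m) where
    private
      G : D.Graph (suc (suc (suc m)))
      G = D.twin (D.cycle (suc (suc m)) 3≤n) zero

    -- The colors come in the order v′, v, then the remaining vertices around the cycle. Both a and
    -- b must avoid the two ends of the walk: the middle condition covers the first end, the base
    -- case of `Path` the last.
    Good : Set
    Good = a ≢ b × ((a ≢ c × b ≢ c) × Path c κ)

    proper⇒good : D.Proper G (a ∷ b ∷ c ∷ κ) → Good
    proper⇒good p =
        p zero (suc zero) (inj₁ ≡.refl)
      , ( p zero (suc (suc zero)) (inj₂ (inj₂ (inj₁ ≡.refl)))
        , p (suc zero) (suc (suc zero)) (inj₁ (inj₁ ≡.refl)))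
      , path-intro c κ
          (λ i j q → p (suc (suc i)) (suc (suc j)) (inj₁ (inj₁ (≡.cong suc q))))
          -- The last vertex closes the cycle: it is adjacent to v, and hence to v′ as well.
          (p zero (suc (suc (fromℕ m))) (inj₂ (inj₁ last-next)))
          (λ q → p (suc (suc (fromℕ m))) (suc zero) (inj₁ last-next) (≡.sym q))
      where
      last-next : D.Next {suc (suc m)} (suc (fromℕ m)) zero
      last-next = inj₂ (≡.cong (ℕ.suc ∘ ℕ.suc) (Fin.toℕ-fromℕ m) , ≡.refl)

    good⇒proper : Good → D.Proper G (a ∷ b ∷ c ∷ κ)
    good⇒proper (a≢b , (a≢c , b≢c) , path) = proper
      where
      next : ∀ u w → D.Next {suc (suc m)} u w → lookup (b ∷ c ∷ κ) u ≢ lookup (b ∷ c ∷ κ) w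
      next zero    (suc zero) (inj₁ _)       = b≢c
      next (suc i) zero       (inj₂ (p , _)) q = proj₂ (path-last c κ path i (ℕ.suc-injective (ℕ.suc-injective p))) (≡.sym q)
      next (suc i) (suc j)    (inj₁ p)       = path-step c κ path i j (ℕ.suc-injective p)

      twin-proper : ∀ u → u ≡ zero ⊎ (D.Next u zero ⊎ D.Next zero u) → a ≢ lookup (b ∷ c ∷ κ) u
      twin-proper zero       _                     = a≢b
      twin-proper (suc i)    (inj₂ (inj₁ (inj₂ (p , _)))) = proj₁ (path-last c κ path i (ℕ.suc-injective (ℕ.suc-injective p)))
      twin-proper (suc zero) (inj₂ (inj₂ (inj₁ _))) = a≢c

      proper : D.Proper G (a ∷ b ∷ c ∷ κ)
      proper zero    (suc w) p = twin-proper w p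
      proper (suc u) zero    p = twin-proper u p ∘ ≡.sym
      proper (suc u) (suc w) (inj₁ p) = next u w p
      proper (suc u) (suc w) (inj₂ p) = next w u p ∘ ≡.sym

chromatic-twinSeries : ∀ k m (3≤n : 3 ≤ suc (suc m)) v →
  R._≈_ k (chromatic k (D.twin (D.cycle (suc (suc m)) 3≤n) v)) (TwinnedCycles.twinSeries (R k) (letter k) (3 ℕ.+ m))
chromatic-twinSeries k m 3≤n v = trans (chromatic-twin-cycle k (suc m) 3≤n v) (trans
  (sum-cong-≋ λ a → sum-cong-≋ λ b → begin
    sum (λ c → csum m (λ κ → ind (D.proper? G (a ∷ b ∷ c ∷ κ)) * (x a * (x b * wt x (c ∷ κ)))))
      ≈⟨ sum-cong-≋ (λ c → begin
           csum m (λ κ → ind (D.proper? G (a ∷ b ∷ c ∷ κ)) * (x a * (x b * wt x (c ∷ κ))))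
             ≈⟨ csum-cong m (λ κ → trans
                  (*-congʳ (indicates-unique (proper⇒good a b 3≤n c κ) (good⇒proper a b 3≤n c κ)
                    (indicates-ind (D.proper? G (a ∷ b ∷ c ∷ κ)))
                    (indicates-× (indicates-neq a b) (indicates-× (indicates-avoid a b c) (indicates-path a b c κ)))))
                  (solve 6 (λ n h p y z w → n :* (h :* p) :* (y :* (z :* w)) := n :* (y :* (z :* h)) :* (p :* w)) refl
                    (neq a b) (avoid a b c) (path x (avoid a b) c κ) (x a) (x b) (wt x (c ∷ κ)))) ⟩
           csum m (λ κ → neq a b * (x a * (x b * avoid a b c)) * (path x (avoid a b) c κ * wt x (c ∷ κ)))
             ≈⟨ sym (*-csum m _ (λ κ → path x (avoid a b) c κ * wt x (c ∷ κ))) ⟩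
           neq a b * (x a * (x b * avoid a b c)) * csum m (λ κ → path x (avoid a b) c κ * wt x (c ∷ κ))
             ≈⟨ *-congˡ (csum-path x (avoid a b) m c) ⟩
           neq a b * (x a * (x b * avoid a b c)) * walk (avoid a b) m c
             ≈⟨ solve 5 (λ n y z h w → n :* (y :* (z :* h)) :* w := n :* (y :* z) :* (h :* w)) refl
                  (neq a b) (x a) (x b) (avoid a b c) (walk (avoid a b) m c) ⟩
           neq a b * (x a * x b) * (avoid a b c * walk (avoid a b) m c) ∎) ⟩
    sum (λ c → neq a b * (x a * x b) * (avoid a b c * walk (avoid a b) m c))
      ≈⟨ sym (*-distribˡ-sum (neq a b * (x a * x b)) (λ c → avoid a b c * walk (avoid a b) m c)) ⟩
    neq a b * (x a * x b) * sum (λ c → avoid a b c * walk (avoid a b) m c)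
      ≈⟨ solve 4 (λ n y z w → n :* (y :* z) :* w := n :* (y :* (z :* w))) refl
           (neq a b) (x a) (x b) (sum (λ c → avoid a b c * walk (avoid a b) m c)) ⟩
    neq a b * (x a * (x b * sum (λ c → avoid a b c * walk (avoid a b) m c))) ∎)
  (sym (twinSeries-coeff m)))
  where
  open ℤ-Algebra (R k)
  open Sum semiring
  open ColorSums (R k) k
  open Weights (R k)
  open TwinnedCycles (R k) (letter k) using (avoid; walk; twinSeries-coeff)
  open Indicator (R k) using (neq)
  open SetoidReasoning setoid
  open Solver (R k) using (solve; _:=_; _:*_)
  x = letter k
  G = D.twin (D.cycle (suc (suc m)) 3≤n) zero
  indicates-avoid : ∀ a b c → Indicates (avoid a b c) (a ≢ c × b ≢ c)
  indicates-avoid a b c = indicates-× (indicates-neq a c) (indicates-neq b c)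
  indicates-path : ∀ a b {l} c (κ : Vec (Fin k) l) → Indicates (path x (avoid a b) c κ) (Path a b c κ)
  indicates-path a b c []      = indicates-avoid a b c
  indicates-path a b c (d ∷ κ) = indicates-× (indicates-neq c d) (indicates-path a b d κ)

-- e-positivity

open import Defs

open Sort (flipOrder ℕ.≤-decTotalOrder) using (sort; sort-↭; sort-↗)

*-cong : ∀ {f f′ g g′} → f ≈ f′ → g ≈ g′ → f * g ≈ f′ * g′
*-cong {f} {f′} {g} {g′} p q = φ-separates λ k → R.trans k (φ-* k f g)
  (R.trans k (R.*-cong k (φ-cong k p) (φ-cong k q)) (R.sym k (φ-* k f′ g′)))

*-comm : ∀ f g → f * g ≈ g * f
*-comm f g = φ-separates λ k → R.trans k (φ-* k f g) (R.trans k (R.*-comm k _ _) (R.sym k (φ-* k g f)))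

*-assoc : ∀ f g h → f * g * h ≈ f * (g * h)
*-assoc f g h = φ-separates λ k → R.trans k (φ-* k (f * g) h) (R.trans k (R.*-congʳ k (φ-* k f g))
  (R.trans k (R.*-assoc k _ _ _) (R.sym k (R.trans k (φ-* k f (g * h)) (R.*-congˡ k (φ-* k g h))))))

*-distribʳ : ∀ h f g → (f + g) * h ≈ f * h + g * h
*-distribʳ h f g = φ-separates λ k → R.trans k (φ-* k (f + g) h) (R.trans k (R.*-congʳ k (φ-+ k f g))
  (R.trans k (R.distribʳ k _ _ _) (R.sym k (R.trans k (φ-+ k (f * h) (g * h)) (R.+-cong k (φ-* k f h) (φ-* k g h))))))

*-identityˡ : ∀ f → 𝟙 * f ≈ f
*-identityˡ f = φ-separates λ k → R.trans k (φ-* k 𝟙 f) (R.trans k (R.*-congʳ k (φ-𝟙 k)) (R.*-identityˡ k _))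

*-zeroˡ : ∀ f → 𝟘 * f ≈ 𝟘
*-zeroˡ f = φ-separates λ k → R.trans k (φ-* k 𝟘 f)
  (R.trans k (R.*-congʳ k (φ-𝟘 k)) (R.trans k (R.zeroˡ k _) (R.sym k (φ-𝟘 k))))

≈-trans : ∀ {f g h : FPS} → f ≈ g → g ≈ h → f ≈ h
≈-trans p q α = ≡.trans (p α) (q α)

≈-sym : ∀ {f g : FPS} → f ≈ g → g ≈ f
≈-sym p α = ≡.sym (p α)

+-cong : ∀ {f f′ g g′ : FPS} → f ≈ f′ → g ≈ g′ → f + g ≈ f′ + g′
+-cong p q α = ≡.cong₂ ℚ._+_ (p α) (q α)

e[]-++ : ∀ μ ν → e[ μ ++ ν ] ≈ e[ μ ] * e[ ν ]
e[]-++ []      ν = ≈-sym (*-identityˡ e[ ν ])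
e[]-++ (i ∷ μ) ν = ≈-trans (*-cong (λ _ → ≡.refl) (e[]-++ μ ν)) (≈-sym (*-assoc (e i) e[ μ ] e[ ν ]))

e[]-↭ : ∀ {μ ν} → μ ↭ ν → e[ μ ] ≈ e[ ν ]
e[]-↭ ↭.refl        α = ≡.refl
e[]-↭ (↭.prep i p)    = *-cong (λ _ → ≡.refl) (e[]-↭ p)
e[]-↭ (↭.swap {μ} {ν} i j p) = ≈-trans (≈-sym (*-assoc (e i) (e j) e[ μ ]))
  (≈-trans (*-cong (*-comm (e i) (e j)) (e[]-↭ p)) (*-assoc (e j) (e i) e[ ν ]))
e[]-↭ (↭.trans p q)   = ≈-trans (e[]-↭ p) (e[]-↭ q)

∑-++ : ∀ fs gs → ∑ (fs ++ gs) ≈ ∑ fs + ∑ gs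
∑-++ []       gs α = ≡.sym (ℚ.+-identityˡ _)
∑-++ (f ∷ fs) gs α = ≡.trans (≡.cong (f α ℚ.+_) (∑-++ fs gs α)) (≡.sym (ℚ.+-assoc (f α) _ _))

∑e : List (List ℕ) → FPS
∑e L = ∑ (map e[_] L)

∑e-++ : ∀ L M → ∑e (L ++ M) ≈ ∑e L + ∑e M
∑e-++ L M = ≈-trans (λ α → ≡.cong (λ fs → ∑ fs α) (List.map-++ e[_] L M)) (∑-++ (map e[_] L) (map e[_] M))

∑e-map-++ : ∀ μ M → ∑e (map (μ ++_) M) ≈ e[ μ ] * ∑e M
∑e-map-++ μ []      = ≈-sym (≈-trans (*-comm e[ μ ] 𝟘) (*-zeroˡ e[ μ ]))
∑e-map-++ μ (ν ∷ M) = ≈-trans (+-cong (e[]-++ μ ν) (∑e-map-++ μ M)) (≈-sym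
  (≈-trans (*-comm e[ μ ] (e[ ν ] + ∑e M)) (≈-trans (*-distribʳ e[ μ ] e[ ν ] (∑e M))
    (+-cong (*-comm e[ ν ] e[ μ ]) (*-comm (∑e M) e[ μ ])))))

∑e-* : ∀ L M → ∑e (cartesianProductWith _++_ L M) ≈ ∑e L * ∑e M
∑e-* []      M = ≈-sym (*-zeroˡ (∑e M))
∑e-* (μ ∷ L) M = ≈-trans (∑e-++ (map (μ ++_) M) (cartesianProductWith _++_ L M))
  (≈-trans (+-cong (∑e-map-++ μ M) (∑e-* L M)) (≈-sym (*-distribʳ (∑e M) e[ μ ] (∑e L))))

-- f is a sum of products of the eᵢ with i ≥ 1, multiplicities being given by
-- repetition.
Pos : FPS → Set
Pos f = ∃ λ L → All (All (0 <_)) L × f ≈ ∑e L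

pos-≈ : ∀ {f g} → f ≈ g → Pos f → Pos g
pos-≈ f≈g (L , ps , p) = L , ps , ≈-trans (≈-sym f≈g) p

pos-𝟘 : Pos 𝟘
pos-𝟘 = [] , [] , λ _ → ≡.refl

pos-𝟙 : Pos 𝟙
pos-𝟙 = [] ∷ [] , [] ∷ [] , λ α → ≡.sym (ℚ.+-identityʳ _)

pos-e : ∀ i → Pos (e (suc i))
pos-e i = (suc i ∷ []) ∷ [] , (s≤s z≤n ∷ []) ∷ [] ,
  λ α → ≡.sym (≡.trans (ℚ.+-identityʳ _) (≡.trans (*-comm (e (suc i)) 𝟙 α) (*-identityˡ (e (suc i)) α)))

pos-+ : ∀ {f g} → Pos f → Pos g → Pos (f + g)
pos-+ (L , ps , p) (M , qs , q) =
  L ++ M , All.++⁺ ps qs , ≈-trans (+-cong p q) (≈-sym (∑e-++ L M))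

pos-* : ∀ {f g} → Pos f → Pos g → Pos (f * g)
pos-* (L , ps , p) (M , qs , q) =
  cartesianProductWith _++_ L M , products ps , ≈-trans (*-cong p q) (≈-sym (∑e-* L M))
  where
  products : ∀ {L} → All (All (0 <_)) L → All (All (0 <_)) (cartesianProductWith _++_ L M)
  products []       = []
  products (p ∷ ps) = All.++⁺ (All.map⁺ (All.map (All.++⁺ p) qs)) (products ps)

pos-• : ∀ n {f} → Pos f → Pos ((+ n / 1) • f)
pos-• zero    {f} pf = pos-≈ (λ α → ≡.sym (ℚ.*-zeroˡ (f α))) pos-𝟘
pos-• (suc n) {f} pf = pos-≈ step (pos-+ pf (pos-• n pf))
  where
  step : f + (+ n / 1) • f ≈ (+ suc n / 1) • f
  step α = ≡.sym (≡.trans (≡.cong (ℚ._* f α) (/1-+ 1ℤ (+ n))) (≡.trans (ℚ.*-distribʳ-+ (f α) 1ℚ (+ n / 1))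
    (≡.cong (ℚ._+ (+ n / 1) ℚ.* f α) (ℚ.*-identityˡ (f α)))))

-- Collecting products of the eᵢ over distinct partitions

private
  _≟ₗ_ : (μ ν : List ℕ) → _
  _≟ₗ_ = List.≡-dec _≟_

  combine : (List ℕ → ℚ) → List (List ℕ) → FPS
  combine c s = ∑ (map (λ μ → c μ • e[ μ ]) s)

  set : List ℕ → ℚ → (List ℕ → ℚ) → List ℕ → ℚ
  set μ q c ν = if does (ν ≟ₗ μ) then q else c ν

  set-same : ∀ μ q c → set μ q c μ ≡ q
  set-same μ q c = ≡.cong (if_then q else c μ) (dec-true (μ ≟ₗ μ) ≡.refl)

  set-other : ∀ {μ ν} q c → μ ≢ ν → set μ q c ν ≡ c ν
  set-other {μ} {ν} q c μ≢ν = ≡.cong (if_then q else c ν) (dec-false (ν ≟ₗ μ) (μ≢ν ∘ ≡.sym))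

  combine-set-other : ∀ {μ s} q c → All (μ ≢_) s → combine (set μ q c) s ≈ combine c s
  combine-set-other q c []       α = ≡.refl
  combine-set-other q c (p ∷ ps) = +-cong (λ α → ≡.cong (ℚ._* _) (set-other q c p)) (combine-set-other q c ps)

  combine-set-∈ : ∀ {μ s} c → Unique s → μ ∈ s → combine (set μ (c μ ℚ.+ 1ℚ) c) s ≈ combine c s + e[ μ ]
  combine-set-∈ {μ} {_ ∷ s} c (ps ∷ u) (here ≡.refl) α = begin
    set μ q c μ ℚ.* m ℚ.+ combine (set μ q c) s α
      ≡⟨ ≡.cong₂ ℚ._+_ (≡.cong (ℚ._* m) (set-same μ q c)) (combine-set-other q c ps α) ⟩
    (c μ ℚ.+ 1ℚ) ℚ.* m ℚ.+ r
      ≡⟨ ≡.cong (ℚ._+ r) (≡.trans (ℚ.*-distribʳ-+ m (c μ) 1ℚ) (≡.cong (c μ ℚ.* m ℚ.+_) (ℚ.*-identityˡ m))) ⟩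
    c μ ℚ.* m ℚ.+ m ℚ.+ r
      ≡⟨ ℚ.+-assoc (c μ ℚ.* m) m r ⟩
    c μ ℚ.* m ℚ.+ (m ℚ.+ r)
      ≡⟨ ≡.cong (c μ ℚ.* m ℚ.+_) (ℚ.+-comm m r) ⟩
    c μ ℚ.* m ℚ.+ (r ℚ.+ m)
      ≡⟨ ≡.sym (ℚ.+-assoc (c μ ℚ.* m) r m) ⟩
    c μ ℚ.* m ℚ.+ r ℚ.+ m ∎
    where
    open ≡.≡-Reasoning
    q = c μ ℚ.+ 1ℚ
    m = e[ μ ] α
    r = combine c s α
  combine-set-∈ {μ} {ν ∷ s} c (ps ∷ u) (there μ∈s) α = ≡.trans
    (≡.cong₂ ℚ._+_ (≡.cong (ℚ._* e[ ν ] α) (set-other _ c (λ μ≡ν → All.lookup ps μ∈s (≡.sym μ≡ν)))) (combine-set-∈ c u μ∈s α))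
    (≡.sym (ℚ.+-assoc (c ν ℚ.* e[ ν ] α) _ _))

  set-nonneg : ∀ {μ s} q c → 0ℚ ℚ.≤ q → All (λ ν → 0ℚ ℚ.≤ c ν) s → All (λ ν → 0ℚ ℚ.≤ set μ q c ν) s
  set-nonneg {μ} q c 0≤q = All.map λ {ν} 0≤cν → nonneg ν 0≤cν
    where
    nonneg : ∀ ν → 0ℚ ℚ.≤ c ν → 0ℚ ℚ.≤ set μ q c ν
    nonneg ν 0≤cν with does (ν ≟ₗ μ)
    ... | true  = 0≤q
    ... | false = 0≤cν

EPositive-≈ : ∀ {f g} → f ≈ g → EPositive f → EPositive g
EPositive-≈ f≈g (E , 0≤) = record
  { support = support ; partitions = partitions ; unique = unique ; coeff = coeff
  ; expands = ≈-trans (≈-sym f≈g) expands } , 0≤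
  where open EExpansion E

EPositive-𝟘 : EPositive 𝟘
EPositive-𝟘 = record
  { support = [] ; partitions = [] ; unique = [] ; coeff = λ _ → 0ℚ ; expands = λ _ → ≡.refl } , []

-- The support has to stay duplicate-free, so a partition that already occurs has its coefficient
-- raised by one, while a new one enters with coefficient 1.
EPositive-+e : ∀ {f μ} → IsPartition μ → EPositive f → EPositive (f + e[ μ ])
EPositive-+e {f} {μ} part (E , 0≤) with any? (μ ≟ₗ_) (EExpansion.support E)
... | yes μ∈s = record
  { support = support ; partitions = partitions ; unique = unique
  ; coeff = set μ (coeff μ ℚ.+ 1ℚ) coeff
  ; expands = ≈-trans (+-cong expands (λ _ → ≡.refl)) (≈-sym (combine-set-∈ coeff unique μ∈s))
  } , set-nonneg (coeff μ ℚ.+ 1ℚ) coeff (ℚ.+-mono-≤ (All.lookup 0≤ μ∈s) (ℚ.nonNegative⁻¹ 1ℚ)) 0≤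
  where open EExpansion E
... | no μ∉s = record
  { support = μ ∷ support ; partitions = part ∷ partitions ; unique = μ≢s ∷ unique
  ; coeff = set μ 1ℚ coeff
  ; expands = λ α → ≡.trans (ℚ.+-comm (f α) (e[ μ ] α)) (≡.cong₂ ℚ._+_
      (≡.sym (≡.trans (≡.cong (ℚ._* e[ μ ] α) (set-same μ 1ℚ coeff)) (ℚ.*-identityˡ (e[ μ ] α))))
      (≈-trans expands (≈-sym (combine-set-other 1ℚ coeff μ≢s)) α))
  } , ≡.subst (0ℚ ℚ.≤_) (≡.sym (set-same μ 1ℚ coeff)) (ℚ.nonNegative⁻¹ 1ℚ) ∷ set-nonneg 1ℚ coeff (ℚ.nonNegative⁻¹ 1ℚ) 0≤
  where
  open EExpansion E
  μ≢s : All (μ ≢_) support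
  μ≢s = All.¬Any⇒All¬ support μ∉s

-- By commutativity, sorting its indices leaves a product unchanged and makes it one indexed by a
-- partition.
Pos⇒EPositive : ∀ {f} → Pos f → EPositive f
Pos⇒EPositive (L , ps , p) = EPositive-≈ (≈-sym p) (expand ps)
  where
  expand : ∀ {L} → All (All (0 <_)) L → EPositive (∑e L)
  expand []                   = EPositive-𝟘
  expand {μ ∷ L} (p ∷ ps) = EPositive-≈
    (λ α → ≡.trans (ℚ.+-comm (∑e L α) (e[ sort μ ] α)) (≡.cong (ℚ._+ ∑e L α) (e[]-↭ (sort-↭ μ) α)))
    (EPositive-+e (sort-↗ μ , All-resp-↭ (↭-sym (sort-↭ μ)) p) (expand ps))

-- Positivity of the numerator and of the reciprocal

PosSeries : Series → Set
PosSeries A = ∀ n → Pos (A n)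

pos-∑ : ∀ {fs} → All Pos fs → Pos (∑ fs)
pos-∑ []       = pos-𝟘
pos-∑ (p ∷ ps) = pos-+ p (pos-∑ ps)

pos-⊛ : ∀ {A B} → PosSeries A → PosSeries B → PosSeries (A ⊛ B)
pos-⊛ {A} {B} a b n = pos-∑ (All.applyUpTo⁺₂ (λ i → A i * B (n ∸ i)) (suc n) (λ i → pos-* (a i) (b (n ∸ i))))

pos-z^ : ∀ {f} i → Pos f → PosSeries (f z^ i)
pos-z^ i p n with does (n ≟ i)
... | true  = p
... | false = pos-𝟘

pos-∑≥ : ∀ k (a : (i : ℕ) → k ≤ i → FPS) → (∀ i k≤i → Pos (a i k≤i)) → PosSeries (∑≥ k a)
pos-∑≥ k a p n with k ≤? n
... | yes k≤n = p n k≤n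
... | no  _   = pos-𝟘

-1• : FPS → FPS
-1• f = (ℚ.- 1ℚ) • f

-1•-* : ∀ q g → -1• (-1• q * g) ≈ q * g
-1•-* q g = φ-separates λ k → lemma k
  where
  lemma : ∀ k → R._≈_ k (φ k (-1• (-1• q * g))) (φ k (q * g))
  lemma k = trans (φ-• k (ℤ.- 1ℤ) (-1• q * g))
    (trans (R.*-congˡ k (trans (φ-* k (-1• q) g) (R.*-congʳ k (φ-• k (ℤ.- 1ℤ) q))))
    (trans (solve 2 (λ q g → con (ℤ.- 1ℤ) :* (con (ℤ.- 1ℤ) :* q :* g) := q :* g) refl (φ k q) (φ k g))
           (sym (φ-* k q g))))
    where
    open ℤ-Algebra (R k) using (trans; sym; refl)
    open Solver (R k) using (solve; con; _:*_; _:=_)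

-1•-+ : ∀ f g → -1• (f + g) ≈ -1• f + -1• g
-1•-+ f g α = ℚ.*-distribˡ-+ (ℚ.- 1ℚ) (f α) (g α)

-- The sign in the recursion for `recip` cancels the sign of A, so a new coefficient is a sum of
-- products of some q i with earlier coefficients, as for a geometric series. All earlier
-- coefficients enter, hence the induction over the whole list `recipCoeffs`.
pos-recip : ∀ A (q : ℕ → FPS) → (∀ i → A (suc i) ≈ -1• (q i)) → (∀ i → Pos (q i)) → PosSeries (recip A)
pos-recip A q A≈ pq n with all-pos n
  where
  dot : (s q : ℕ → FPS) → (∀ i → s i ≈ -1• (q i)) → (∀ i → Pos (q i)) →
        ∀ m {gs} → All Pos gs → Pos (-1• (∑ (zipWith _*_ (applyUpTo s m) gs)))
  dot s q s≈ pq zero    _        = pos-𝟘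
  dot s q s≈ pq (suc m) []       = pos-𝟘
  dot s q s≈ pq (suc m) {g ∷ gs} (p ∷ ps) = pos-≈
    (≈-sym (≈-trans (-1•-+ (s 0 * g) _) (+-cong
      (≈-trans (λ α → ≡.cong ((ℚ.- 1ℚ) ℚ.*_) (*-cong (s≈ 0) (λ _ → ≡.refl) α)) (-1•-* (q 0) g)) (λ _ → ≡.refl))))
    (pos-+ (pos-* (pq 0) p) (dot (s ∘ suc) (q ∘ suc) (s≈ ∘ suc) (pq ∘ suc) m ps))

  all-pos : ∀ n → All Pos (recipCoeffs A n)
  all-pos zero    = pos-𝟙 ∷ []
  all-pos (suc n) = dot (λ i → A (suc i)) q A≈ pq (suc n) (all-pos n) ∷ all-pos n
pos-recip A q A≈ pq zero    | p ∷ _ = p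
pos-recip A q A≈ pq (suc n) | p ∷ _ = p

pos-term : ∀ {c m} i → c ≡ + m → Pos ((c / 1) • e (suc i))
pos-term {m = m} i ≡.refl = pos-• m (pos-e i)

+-polynomial : ∀ a b c i → + (a ℕ.* i ℕ.* i ℕ.+ b ℕ.* i ℕ.+ c) ≡ + a · + i · + i +ᶻ + b · + i +ᶻ + c
+-polynomial a b c i = ≡.cong₂ (λ u v → u +ᶻ v +ᶻ + c)
  (≡.trans (ℤ.pos-* (a ℕ.* i) i) (≡.cong (_· + i) (ℤ.pos-* a i))) (ℤ.pos-* b i)

-- Expansion around the first index of the sum leaves a polynomial with natural coefficients, which
-- makes every later value visibly a natural number, as `pos-term` requires.
f₂-nonneg : ∀ i → f₂ (3 ℕ.+ i) ≡ + (2 ℕ.* i ℕ.* i ℕ.+ 7 ℕ.* i ℕ.+ 3)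
f₂-nonneg i = ≡.trans (solve 1 (λ i → let j = con (+ 3) :+ i in
    con (+ 2) :* j :* j :- con (+ 5) :* j := con (+ 2) :* i :* i :+ con (+ 7) :* i :+ con (+ 3)) ≡.refl (+ i))
  (≡.sym (+-polynomial 2 7 3 i))
  where open ℤSolver

f₃-nonneg : ∀ i → f₃ (4 ℕ.+ i) ≡ + (1 ℕ.* i ℕ.* i ℕ.+ 4 ℕ.* i ℕ.+ 3)
f₃-nonneg i = ≡.trans (solve 1 (λ i → let j = con (+ 4) :+ i in
    (j :- con (+ 1)) :* (j :- con (+ 3)) := con (+ 1) :* i :* i :+ con (+ 4) :* i :+ con (+ 3)) ≡.refl (+ i))
  (≡.sym (+-polynomial 1 4 3 i))
  where open ℤSolver

j-nonneg : ∀ i → jᵢ (3 ℕ.+ i) ≡ + (2 ℕ.* i ℕ.* i ℕ.+ 6 ℕ.* i ℕ.+ 2)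
j-nonneg i = ≡.trans (solve 1 (λ i → let j = con (+ 3) :+ i in
    con (+ 2) :* j :* j :- con (+ 6) :* j :+ con (+ 2) := con (+ 2) :* i :* i :+ con (+ 6) :* i :+ con (+ 2)) ≡.refl (+ i))
  (≡.sym (+-polynomial 2 6 2 i))
  where open ℤSolver

d-nonneg : ∀ i → dᵢ (suc i) ≡ + i
d-nonneg i = ≡.refl

-- The generating function

open import Data.Integer using (_-_)

φ-z^ : ∀ k f i n → R._≈_ k (φ k ((f z^ i) n)) (Ser.mono k i (φ k f) n)
φ-z^ k f i n with does (n ≟ i)
... | true  = R.refl k
... | false = φ-𝟘 k

φ-∑≥e : ∀ k m (c : ℕ → ℤ) n →
  R._≈_ k (φ k (∑≥ m (λ i _ → (c i / 1) • e i) n)) (Ser.from k m c (Ser.E k (letter k)) n)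
φ-∑≥e k m c n with m ≤? n
... | yes m≤n = R.trans k (R.trans k (φ-• k (c n) (e n)) (R.*-congˡ k (φ-e k n)))
  (R.reflexive k (≡.cong (if_then _ else R.0# k) (≡.sym (dec-true (m ≤? n) m≤n))))
... | no  m≰n = R.trans k (φ-𝟘 k)
  (R.reflexive k (≡.cong (if_then _ else R.0# k) (≡.sym (dec-false (m ≤? n) m≰n))))

shift-⊛ : ∀ B n → ((𝟙 z^ 1) ⊛ B) (suc n) ≈ B n
shift-⊛ B n = φ-separates λ k → R.trans k (φ-⊛ k (𝟙 z^ 1) B (suc n))
  (R.trans k (Ser.*ₛ-cong k (λ m → R.trans k (φ-z^ k 𝟙 1 m) (R.trans k (Ser.mono-cong k 1 (φ-𝟙 k) m) (mono-1 k m)))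
                            (λ _ → R.refl k) (suc n))
  (R.trans k (Ser.var-*ₛ k (R.1# k) (φ k ∘ B) (suc n)) (R.*-identityˡ k _)))
  where
  mono-1 : ∀ k n → R._≈_ k (Ser.mono k 1 (R.1# k) n) (Ser.var k (R.1# k) n)
  mono-1 k zero          = R.refl k
  mono-1 k (suc zero)    = R.refl k
  mono-1 k (suc (suc n)) = R.refl k

φ-z^e : ∀ k i → Ser._≈ₛ_ k (φ k ∘ (e i z^ i)) (Ser.mono k i (Ser.E k (letter k) i))
φ-z^e k i n = R.trans k (φ-z^ k (e i) i n) (Ser.mono-cong k i (φ-e k i) n)

φ-⊕ : ∀ k {A B A′ B′} → Ser._≈ₛ_ k (φ k ∘ A) A′ → Ser._≈ₛ_ k (φ k ∘ B) B′ →
  Ser._≈ₛ_ k (φ k ∘ (A ⊕ B)) (Ser._+ₛ_ k A′ B′)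
φ-⊕ k {A} {B} p q n = R.trans k (φ-+ k (A n) (B n)) (R.+-cong k (p n) (q n))

φ-⊛-cong : ∀ k {A B A′ B′} → Ser._≈ₛ_ k (φ k ∘ A) A′ → Ser._≈ₛ_ k (φ k ∘ B) B′ →
  Ser._≈ₛ_ k (φ k ∘ (A ⊛ B)) (Ser._*ₛ_ k A′ B′)
φ-⊛-cong k {A} {B} p q n = R.trans k (φ-⊛ k A B n) (Ser.*ₛ-cong k p q n)

φ-1⊖ : ∀ k {Q Q′} → Ser._≈ₛ_ k (φ k ∘ Q) Q′ →
  Ser._≈ₛ_ k (φ k ∘ ((𝟙 z^ 0) ⊖ Q)) (R._-_ (suc k) (Ser.1ₛ k) Q′)
φ-1⊖ k {Q} {Q′} p n = trans (φ-+ k ((𝟙 z^ 0) n) ((ℚ.- 1ℚ) • Q n)) (R.+-cong k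
  (trans (φ-z^ k 𝟙 0 n) (trans (Ser.mono-cong k 0 (φ-𝟙 k) n) (Ser.mono-0 k 1# n)))
  (trans (φ-• k (ℤ.- 1ℤ) (Q n)) (trans (R.*-congˡ k (p n))
    (solve 1 (λ a → con (ℤ.- 1ℤ) :* a := :- a) refl (Q′ n)))))
  where
  open ℤ-Algebra (R k) using (trans; refl; 1#)
  open Solver (R k) using (solve; con; _:*_; _:=_; :-_)

-- Numerator and denominator are parameters, so the long expressions of the theorem never unfold in
-- these proofs; unification supplies them at the end.
module Quotient (N D : Series) (D-0 : D 0 ≈ 𝟙)
  (φ-N : ∀ k → Ser._≈ₛ_ k (φ k ∘ N) (TwinnedCycles.numerator (R k) (letter k)))
  (φ-D : ∀ k → Ser._≈ₛ_ k (φ k ∘ D) (R._-_ (suc k) (Ser.1ₛ k) (TwinnedCycles.D₂ (R k) (letter k))))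
  where

  module _ (k : ℕ) where
    open ℤ-Algebra (R k) hiding (_≈_; _+_; _*_)
    open TwinnedCycles (R k) (letter k)
    open Elementary (R k)

    private
      r : PS
      r = φ k ∘ recip D

    φ-recip : (1ₛ S.- D₂) *ₛ r ≈ₛ 1ₛ
    φ-recip = S.trans (S.*-congʳ {r} (S.sym (φ-D k))) (S.trans (λ n → sym (φ-⊛ k D (recip D) n))
      (S.trans (λ n → φ-cong k (⊛-recip D D-0 n)) (S.trans (φ-z^ k 𝟙 0) (S.trans (mono-cong 0 (φ-𝟙 k)) (mono-0 1#)))))

    φ-⊘ : φ k ∘ (N ⊘ D) ≈ₛ numerator *ₛ r
    φ-⊘ n = trans (φ-⊛ k N (recip D) n) (S.*-congʳ {r} (φ-N k) n)

    twinSeries-⊘ : twinSeries ≈ₛ S.κ (+ 2) *ₛ (F₂ +ₛ φ k ∘ (N ⊘ D))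
    twinSeries-⊘ = begin
      twinSeries
        ≈⟨ S.sym (S.*-identityˡ twinSeries) ⟩
      1ₛ *ₛ twinSeries
        ≈⟨ S.*-congʳ {twinSeries} (S.sym φ-recip) ⟩
      (1ₛ S.- D₂) *ₛ r *ₛ twinSeries
        ≈⟨ solve 3 (λ D r t → D :* r :* t := r :* (D :* t)) S.refl (1ₛ S.- D₂) r twinSeries ⟩
      r *ₛ ((1ₛ S.- D₂) *ₛ twinSeries)
        ≈⟨ S.*-congˡ {r} twinSeries-rational ⟩
      r *ₛ (S.κ (+ 2) *ₛ (F₂ *ₛ (1ₛ S.- D₂) +ₛ numerator))
        ≈⟨ solve 4 (λ D r F N → r :* (con (+ 2) :* (F :* D :+ N)) := con (+ 2) :* (F :* (D :* r) :+ N :* r))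
             S.refl (1ₛ S.- D₂) r F₂ numerator ⟩
      S.κ (+ 2) *ₛ (F₂ *ₛ ((1ₛ S.- D₂) *ₛ r) +ₛ numerator *ₛ r)
        ≈⟨ S.*-congˡ {S.κ (+ 2)} (S.+-cong (S.trans (S.*-congˡ {F₂} φ-recip) (S.*-identityʳ F₂)) (S.sym φ-⊘)) ⟩
      S.κ (+ 2) *ₛ (F₂ +ₛ φ k ∘ (N ⊘ D)) ∎
      where
      open SetoidReasoning S.setoid
      open SolveS using (solve; con; _:*_; _:+_; _:=_)

    from-order : ∀ m c A i → i < m → R._≈_ k (from m c A i) 0#
    from-order m c A i i<m = reflexive (≡.cong (if_then _ else 0#) (dec-false (m ≤? i) (ℕ.<⇒≱ i<m)))

    mono-order : ∀ m r i → i < m → R._≈_ k (mono m r i) 0#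
    mono-order m r i i<m = reflexive (≡.cong (if_then r else 0#) (dec-false (i ≟ m) (ℕ.<⇒≢ i<m)))

    -- The three products start at z · z⁴, z³ · z³ and z² · z³. Hence the quotient adds nothing
    -- below z⁴, where the left-hand side of the theorem begins.
    numerator-order : ∀ n → n < 5 → R._≈_ k (numerator n) 0#
    numerator-order n n<5 = trans (R.+-cong k (trans (R.+-cong k
        (*ₛ-order 1 4 (mono-order 1 _) (from-order 4 f₃ _) n n<5)
        (*ₛ-order 3 3 (from-order 3 f₂ _) (from-order 3 dᵢ _) n (ℕ.m<n⇒m<1+n n<5))) (+-identityˡ 0#))
        (*ₛ-order 2 3 (mono-order 2 _) (from-order 3 jᵢ _) n n<5)) (+-identityˡ 0#)

    φ-⊘-order : ∀ n → n < 5 → R._≈_ k (φ k ((N ⊘ D) n)) 0#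
    φ-⊘-order n n<5 = trans (φ-⊘ n) (*ₛ-order 5 0 numerator-order (λ _ ()) n n<5)

  ⊘-order : ∀ n → n < 5 → (N ⊘ D) n ≈ 𝟘
  ⊘-order n n<5 = φ-separates λ k → R.trans k (φ-⊘-order k n n<5) (R.sym k (φ-𝟘 k))

  X-twin-cycle : ∀ n 3≤n v → ½ • X (twin (cycle n 3≤n) v) ≈ (f₂ (suc n) / 1) • e (suc n) + (N ⊘ D) (suc n)
  X-twin-cycle (suc zero) (s≤s ())
  X-twin-cycle (suc (suc m)) 3≤n v α = begin
    ½ ℚ.* X G α                                         ≡⟨ ≡.cong (½ ℚ.*_) (X-chromatic G α) ⟩
    ½ ℚ.* ev α (chromatic k G)
      ≡⟨ ≡.cong (½ ℚ.*_) (ev-cong α (R.trans k (chromatic-twinSeries k m 3≤n v)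
           (R.trans k (twinSeries-⊘ k n) (R.trans k (Ser.const-*ₛ k (R.κ k (+ 2)) _ n) (R.*-congˡ k (R.sym k (φ-rhs k))))))) ⟩
    ½ ℚ.* ev α (R._*_ k (R.κ k (+ 2)) (φ k rhs))        ≡⟨ ≡.cong (½ ℚ.*_) (ev-κ α (+ 2) (φ k rhs)) ⟩
    ½ ℚ.* ((+ 2 / 1) ℚ.* ev α (φ k rhs))                ≡⟨ ≡.sym (ℚ.*-assoc ½ (+ 2 / 1) (ev α (φ k rhs))) ⟩
    -- ½ · (2 / 1) computes to 1ℚ: here the factor 2 that comes from the ordered pairs (a, b)
    -- disappears.
    1ℚ ℚ.* ev α (φ k rhs)                               ≡⟨ ℚ.*-identityˡ _ ⟩
    ev α (φ k rhs)                                      ≡⟨ ev-φ α rhs ⟩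
    rhs α                                               ∎
    where
    open ≡.≡-Reasoning
    k = length α
    n = 3 ℕ.+ m
    G = twin (cycle (suc (suc m)) 3≤n) v
    rhs : FPS
    rhs = (f₂ n / 1) • e n + (N ⊘ D) n
    φ-rhs : ∀ k → R._≈_ k (φ k rhs) (R._+_ k (TwinnedCycles.F₂ (R k) (letter k) n) (φ k ((N ⊘ D) n)))
    φ-rhs k = R.trans k (φ-+ k ((f₂ n / 1) • e n) ((N ⊘ D) n)) (R.+-congʳ k (φ-∑≥e k 3 f₂ n))

pos-⊕ : ∀ {A B} → PosSeries A → PosSeries B → PosSeries (A ⊕ B)
pos-⊕ a b n = pos-+ (a n) (b n)

pos-recip-1⊖ : ∀ {Q} → PosSeries Q → PosSeries (recip ((𝟙 z^ 0) ⊖ Q))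
pos-recip-1⊖ {Q} q = pos-recip ((𝟙 z^ 0) ⊖ Q) (Q ∘ suc) (λ i α → ℚ.+-identityˡ _) (q ∘ suc)

PosSeries⇒EPositiveSeries : ∀ {A} → PosSeries A → EPositiveSeries A
PosSeries⇒EPositiveSeries p n = Pos⇒EPositive (p n)

pos-f₂ : ∀ i → 3 ≤ i → Pos ((f₂ i / 1) • e i)
pos-f₂ (suc (suc (suc i))) _ = pos-term (2 ℕ.+ i) (f₂-nonneg i)
pos-f₂ (suc (suc zero)) (s≤s (s≤s ()))
pos-f₂ (suc zero) (s≤s ())

pos-f₃ : ∀ i → 4 ≤ i → Pos ((f₃ i / 1) • e i)
pos-f₃ (suc (suc (suc (suc i)))) _ = pos-term (3 ℕ.+ i) (f₃-nonneg i)
pos-f₃ (suc zero) (s≤s ())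
pos-f₃ (suc (suc zero)) (s≤s (s≤s ()))
pos-f₃ (suc (suc (suc zero))) (s≤s (s≤s (s≤s ())))

pos-j : ∀ i → 3 ≤ i → Pos ((jᵢ i / 1) • e i)
pos-j (suc (suc (suc i))) _ = pos-term (2 ℕ.+ i) (j-nonneg i)
pos-j (suc (suc zero)) (s≤s (s≤s ()))
pos-j (suc zero) (s≤s ())

pos-d : ∀ {m} → 0 < m → ∀ i → m ≤ i → Pos ((dᵢ i / 1) • e i)
pos-d _   (suc i) _   = pos-term i (d-nonneg i)
pos-d 0<m zero    m≤0 = contradiction 0<m (ℕ.≤⇒≯ m≤0)

-- A summand may depend on the proof of m ≤ n, as the cycle does; irrelevance of ≤ makes the choice
-- of proof immaterial.
∑≥-≥ : ∀ {m n} a (m≤n : m ≤ n) → ∑≥ m a n ≡ a n m≤n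
∑≥-≥ {m} {n} a m≤n with m ≤? n
... | yes m≤n′ = ≡.cong (a n) (ℕ.≤-irrelevant m≤n′ m≤n)
... | no  m≰n  = contradiction m≤n m≰n

∑≥-< : ∀ {m n} a → n < m → ∑≥ m a n ≡ 𝟘
∑≥-< {m} {n} a n<m with m ≤? n
... | yes m≤n = contradiction m≤n (ℕ.<⇒≱ n<m)
... | no  _   = ≡.refl

-- Below z⁴ both sides vanish: the left by the factor z and the start at n = 3, the right by the
-- start at 4 and the order of C. From z⁴ on the comparison is coefficientwise.
½z⊛-expansion : ∀ a b (C : Series) → (∀ n → n < 5 → C n ≈ 𝟘) →
  (∀ n 3≤n 4≤1+n → ½ • b n 3≤n ≈ a (suc n) 4≤1+n + C (suc n)) →
  ½ ⊙ ((𝟙 z^ 1) ⊛ ∑≥ 3 b) ≋ ∑≥ 4 a ⊕ C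
½z⊛-expansion a b C C≈𝟘 high zero α = ≡.trans (≡.cong (λ q → ½ ℚ.* (q ℚ.+ 0ℚ)) (*-zeroˡ 𝟘 α))
  (≡.sym (≡.trans (ℚ.+-identityˡ _) (C≈𝟘 0 (s≤s z≤n) α)))
½z⊛-expansion a b C C≈𝟘 high (suc n) α = case 3 ≤? n of λ where
  (yes 3≤n) → ≡.trans
    (≡.cong (½ ℚ.*_) (≡.trans (shift-⊛ (∑≥ 3 b) n α) (≡.cong (λ f → f α) (∑≥-≥ b 3≤n))))
    (≡.trans (high n 3≤n (s≤s 3≤n) α) (≡.cong (λ f → f α ℚ.+ C (suc n) α) (≡.sym (∑≥-≥ a (s≤s 3≤n)))))
  (no 3≰n) → let n<3 = ℕ.≰⇒> 3≰n in ≡.trans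
    (≡.cong (½ ℚ.*_) (≡.trans (shift-⊛ (∑≥ 3 b) n α) (≡.cong (λ f → f α) (∑≥-< b n<3))))
    (≡.trans (ℚ.*-zeroʳ ½) (≡.sym (≡.cong₂ ℚ._+_
      (≡.cong (λ f → f α) (∑≥-< a (s≤s n<3))) (C≈𝟘 (suc n) (s≤s (ℕ.m<n⇒m<1+n n<3)) α))))

theorem3p29 :
    (v : (n : ℕ) → 3 ≤ n → Fin n) →
    let
      F₂ = ∑≥ 3 λ i _ → ((+ 2 · + i · + i - + 5 · + i) / 1) • e i
      F₃ = ∑≥ 4 λ i _ → (((+ i - + 1) · (+ i - + 3)) / 1) • e i
      numerator =
        (e 1 z^ 1) ⊛ F₃
          ⊕ F₂ ⊛ (∑≥ 3 λ i _ → ((+ i - + 1) / 1) • e i)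
          ⊕ (e 2 z^ 2) ⊛ (∑≥ 3 λ i _ → ((+ 2 · + i · + i - + 6 · + i +ᶻ + 2) / 1) • e i)
      denominator = (𝟙 z^ 0) ⊖ (∑≥ 2 λ i _ → ((+ i - + 1) / 1) • e i)
      rhs = (∑≥ 4 λ i _ → ((+ 2 · + i · + i - + 5 · + i) / 1) • e i) ⊕ numerator ⊘ denominator
    in
    (½ ⊙ ((𝟙 z^ 1) ⊛ (∑≥ 3 λ n 3≤n → X (twin (cycle n 3≤n) (v n 3≤n)))) ≋ rhs)
      × EPositiveSeries rhs
theorem3p29 v =
    ½z⊛-expansion _ _ _ Q.⊘-order (λ n 3≤n _ → Q.X-twin-cycle n 3≤n (v n 3≤n))
  , PosSeries⇒EPositiveSeries
      (pos-⊕ (pos-∑≥ 4 _ (λ i 4≤i → pos-f₂ i (ℕ.≤-trans (ℕ.n≤1+n 3) 4≤i)))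
        (pos-⊛
          (pos-⊕ (pos-⊕ (pos-⊛ (pos-z^ 1 (pos-e 0)) (pos-∑≥ 4 _ pos-f₃))
                        (pos-⊛ (pos-∑≥ 3 _ pos-f₂) (pos-∑≥ 3 _ (pos-d (s≤s z≤n)))))
                 (pos-⊛ (pos-z^ 2 (pos-e 1)) (pos-∑≥ 3 _ pos-j)))
          (pos-recip-1⊖ (pos-∑≥ 2 _ (pos-d (s≤s z≤n))))))
  where
  module Q = Quotient _ _
    -- The sum in the denominator starts at 2, so its coefficient at z⁰ is zero and the constant
    -- term of the denominator is 𝟙.
    (λ α → ≡.trans (≡.cong (𝟙 α ℚ.+_) (ℚ.*-zeroʳ (ℚ.- 1ℚ))) (ℚ.+-identityʳ (𝟙 α)))
    (λ k → φ-⊕ k (φ-⊕ k (φ-⊛-cong k (φ-z^e k 1) (φ-∑≥e k 4 f₃))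
                        (φ-⊛-cong k (φ-∑≥e k 3 f₂) (φ-∑≥e k 3 dᵢ)))
                 (φ-⊛-cong k (φ-z^e k 2) (φ-∑≥e k 3 jᵢ)))
    (λ k → φ-1⊖ k (φ-∑≥e k 2 dᵢ))
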